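{- Let $\boldsymbol d=\boldsymbol{\Pi}^0_3\setminus\boldsymbol{\Delta}^0_3$ be the Wadge degree of the complete $\boldsymbol{\Pi}^0_3$ subsets of $2^\omega$, and $\mathscr W_{\boldsymbol d}=\{[A]\in\mathrm{MALG}:\Phi(A)\in\boldsymbol d\}$. Then $\mathscr W_{\boldsymbol d}$ is dense in $\mathrm{MALG}$ in the sense of forcing: for every $[A]\in\mathrm{MALG}$ with $\mu(A)>0$ there is $[B]\in\mathscr W_{\boldsymbol d}$ with $\mu(B)>0$ and $\mu(B\setminus A)=0$. Moreover $\boldsymbol d$ is the unique Wadge degree $\boldsymbol e$ for which $\mathscr W_{\boldsymbol e}=\{[A]:\Phi(A)\in\boldsymbol e\}$ is dense in this sense.
   Context: $2^\omega$ is the Cantor space; $N_s=\{x:s\subset x\}$; $\mu$ is the coin-tossing measure, $\mu(N_s)=2^{ -\mathrm{lh}(s)}$. $\Phi(A)=\{x:\lim_n\mu(A\cap N_{x\restriction n})/\mu(N_{x\restriction n})=1\}$. $\mathrm{MALG}$ is the measure algebra of measurable sets modulo null sets, partially ordered by $[A]\le[B]\iff\mu(A\setminus B)=0$, with least element $0=[\emptyset]$. A set $D\subseteq\mathrm{MALG}\setminus\{0\}$ is dense in the sense of forcing if every $b\in\mathrm{MALG}\setminus\{0\}$ has some $d\in D$ with $d\le b$. $\boldsymbol{\Pi}^0_3$: $F_{\sigma\delta}$ sets; $\boldsymbol{\Delta}^0_3$: sets both $F_{\sigma\delta}$ and $G_{\delta\sigma}$. A Wadge degree is an equivalence class under $X\equiv_W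 Y$, where $X\le_W Y$ iff $X=f^{ -1}(Y)$ for a continuous $f:2^\omega\to2^\omega$. -}

module Defs where

open import Data.Bool.Base using (Bool)
open import Data.List.Base using (List; []; _∷_; length; foldr; applyUpTo)
open import Data.Nat.Base as ℕ using (ℕ)
open import Data.Product.Base using (Σ-syntax; ∃-syntax; _×_)
open import Data.Rational.Base using (ℚ; 0ℚ; 1ℚ; ½; _+_; _-_; _*_; _<_; _≤_)
open import Function.Base using (_∘_)
open import Function.Bundles using (_⇔_)
open import Level using (0ℓ) renaming (suc to lsuc)
open import Relation.Binary.PropositionalEquality.Core using (_≡_)
open import Relation.Nullary.Negation.Core using (¬_)
open import Relation.Unary

-- Sequences are compared only through their finite initial segments, so no
-- function extensionality is needed.
Cantor : Set
Cantor = ℕ → Bool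

PointSet : Set₁
PointSet = Pred Cantor 0ℓ

_↾_ : Cantor → ℕ → List Bool
x ↾ n = applyUpTo x n

N : List Bool → PointSet
N s x = x ↾ length s ≡ s

IsOpen : PointSet → Set
IsOpen U = ∀ {x} → x ∈ U → ∃[ n ] N (x ↾ n) ⊆ U

IsClosed : PointSet → Set
IsClosed F = IsOpen (∁ F)

Continuous : (Cantor → Cantor) → Set
Continuous f = ∀ x n → ∃[ m ] N (x ↾ m) ⊆ f ⊢ N (f x ↾ n)

------------------------------------------------------------------------
-- Borel classes and Wadge degrees

-- F_σδ sets
Π⁰₃ : Pred PointSet (lsuc 0ℓ)
Π⁰₃ A = Σ[ F ∈ (ℕ → ℕ → PointSet) ]
  (∀ n m → IsClosed (F n m)) × A ≐ ⋂[ n ∶ ℕ ] ⋃[ m ∶ ℕ ] F n m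

-- G_δσ sets
Σ⁰₃ : Pred PointSet (lsuc 0ℓ)
Σ⁰₃ A = Σ[ U ∈ (ℕ → ℕ → PointSet) ]
  (∀ n m → IsOpen (U n m)) × A ≐ ⋃[ n ∶ ℕ ] ⋂[ m ∶ ℕ ] U n m

Δ⁰₃ : Pred PointSet (lsuc 0ℓ)
Δ⁰₃ = Π⁰₃ ∩ Σ⁰₃

infix 4 _≤W_ _≡W_

_≤W_ : PointSet → PointSet → Set
X ≤W Y = Σ[ f ∈ (Cantor → Cantor) ] Continuous f × X ≐ f ⊢ Y

_≡W_ : PointSet → PointSet → Set
X ≡W Y = X ≤W Y × Y ≤W X

IsWadgeDegree : Pred PointSet (lsuc 0ℓ) → Set₁
IsWadgeDegree 𝐞 = Σ[ X ∈ PointSet ] (∀ Y → Y ∈ 𝐞 ⇔ Y ≡W X)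

𝐝 : Pred PointSet (lsuc 0ℓ)
𝐝 = Π⁰₃ ∖ Δ⁰₃

------------------------------------------------------------------------
-- The coin-tossing measure

-- The real number μ(A) is given by its comparisons with rationals; the
-- basic comparison is the outer measure induced by μ(N_s) = 2^(-lh(s)),
-- which agrees with μ on measurable sets.

μN : List Bool → ℚ
μN []      = 1ℚ
μN (_ ∷ s) = ½ * μN s

-- A is covered by basic open sets of total measure less than q.  The bound r
-- keeps the infinite sum, and not just its partial sums, strictly below q.
μ[_]<_ : PointSet → ℚ → Set
μ[ A ]< q = Σ[ s ∈ (ℕ → List Bool) ]
  A ⊆ ⋃[ i ∶ ℕ ] N (s i) ×
  (∃[ r ] r < q × (∀ n → foldr _+_ 0ℚ (applyUpTo (μN ∘ s) n) ≤ r))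

μ[_]≥_ : PointSet → ℚ → Set
μ[ A ]≥ q = ¬ (μ[ A ]< q)

μ[_]≤_ : PointSet → ℚ → Set
μ[ A ]≤ q = ∀ {r} → q < r → μ[ A ]< r

Null : PointSet → Set
Null A = μ[ A ]≤ 0ℚ

Positive : PointSet → Set
Positive A = ∃[ q ] 0ℚ < q × μ[ A ]≥ q

-- Lebesgue measurability by outer approximation with open sets.
Measurable : PointSet → Set₁
Measurable A = ∀ {ε} → 0ℚ < ε →
  Σ[ U ∈ PointSet ] IsOpen U × A ⊆ U × μ[ U ∖ A ]< ε

-- The density condition |μ(A ∩ N_s)/μ(N_s) - 1| ≤ ε, for s an initial segment
-- of x, is written with the positive denominator cleared.
Φ : PointSet → PointSet
Φ A x = ∀ {ε} → 0ℚ < ε → ∃[ n₀ ] (∀ {n} → n₀ ℕ.≤ n →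
  μ[ A ∩ N (x ↾ n) ]≥ ((1ℚ - ε) * μN (x ↾ n)) ×
  μ[ A ∩ N (x ↾ n) ]≤ ((1ℚ + ε) * μN (x ↾ n)))

------------------------------------------------------------------------
-- The measure algebra

-- Elements are represented by measurable sets; [A] = [B] means A ⊑ B and
-- B ⊑ A.
record MALG : Set₁ where
  field
    set        : PointSet
    measurable : Measurable set

open MALG public

infix 4 _⊑_

_⊑_ : MALG → MALG → Set
B ⊑ A = Null (set B ∖ set A)

-- Invariant under equality in MALG when 𝐞 is a Wadge degree, since Φ(A)
-- depends only on [A] and Wadge degrees respect ≐.
𝒲 : Pred PointSet (lsuc 0ℓ) → Pred MALG (lsuc 0ℓ)
𝒲 𝐞 A = Φ (set A) ∈ 𝐞

-- For measurable A, [A] is nonzero exactly when μ(A) > 0.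
Dense : Pred MALG (lsuc 0ℓ) → Set₁
Dense D = ∀ A → Positive (set A) →
  Σ[ B ∈ MALG ] B ∈ D × Positive (set B) × B ⊑ A

{-# OPTIONS --safe #-}

-- All sets in 𝐝 are Wadge equivalent to 𝐗, the set of x whose events tend to
-- infinity.  Every Π⁰₃ set reduces to 𝐗 by a contraction, and a fixed point
-- argument shows that 𝐗 is not Σ⁰₃.  Conversely let Y = ⋂ₙ ⋃ₘ F n m be Π⁰₃ but not
-- Σ⁰₃.  Call D separated if Y agrees on D with a Σ⁰₃ set.  Inside every
-- non-separated closed set D there are a nonempty closed C and a k such that
-- below every cylinder meeting C one can enter any finite stage of the G_δ set
-- ⋂ⱼ ∁ (F k j) while staying non-separated in C: otherwise, for every k,
-- countably many separated closed sets would absorb the k-th part of the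
-- complement of Y, leaving only a G_δ subset of Y.  Iterating this gives nested
-- closed sets C₀ ⊇ C₁ ⊇ … with Cₙ₊₁ ⊆ F n mₙ.  An event n moves one stage further
-- into the G_δ set of Cₙ and rebuilds everything above level n, so the limit is
-- in Y exactly when the events tend to infinity.
--
-- For Φ(B) the same dynamics is driven by relative measure.  If B is positive
-- and almost contained in the complement of a dense open set, then an event n
-- lets the density fall below 1 - 2⁻ⁿ⁻² on the way to a null cylinder, stopping
-- at the first failure, where the density is still at least 1 - 2⁻ⁿ⁻¹, and then
-- climb again.  A maximal inequality shows that it can climb without falling
-- below 1 - 2⁻ⁿ.  Hence 𝐗 ≤W Φ(B).  Since every positive A meets a closed set with
-- dense open complement of small measure in a positive set, 𝒲 𝐝 is dense; and
-- below such a closed set no other degree can occur, which gives uniqueness.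

module Submission where

open import Axiom.ExcludedMiddle using (ExcludedMiddle)
open import Data.Bool.Base using (Bool; true; false; not; if_then_else_)
open import Data.Empty using (⊥; ⊥-elim)
open import Data.List.Base using (List; []; _∷_; _++_; _∷ʳ_; length; applyUpTo; replicate; foldr)
open import Data.List.Properties
  using (∷-injective; length-++; length-applyUpTo; length-replicate; applyUpTo-∷ʳ; ++-assoc; ++-identityʳ; ∷ʳ-++)
open import Data.Nat.Base as ℕ using (ℕ; zero; suc; z≤n; s≤s; _⊓_; _⊔_)
open import Data.Nat.Properties as ℕₚ
  using (m⊓n≤n; n≤1+n; n<1+n; m<n⇒m<1+n; m≤n⇒m<n∨m≡n; m≤m+n; m≤n+m; m≤m⊔n; m≤n⊔m)
open import Data.Product.Base using (Σ-syntax; ∃-syntax; _×_; _,_; proj₁; proj₂)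
open import Data.Rational.Solver using (module +-*-Solver)
open import Data.Sum.Base using (_⊎_; inj₁; inj₂)
open import Data.Unit.Base using (⊤; tt)
open import Function.Base using (_∘_; id)
open import Function.Bundles using (mk⇔; module Equivalence)
open import Level using (0ℓ; Lift; lift; lower) renaming (suc to lsuc)
open import Relation.Binary.PropositionalEquality
open import Relation.Nullary using (¬_; Dec; yes; no)
open import Relation.Nullary.Decidable using (map′; True; toWitness; fromWitness; isYes; decidable-stable)
open import Relation.Unary
open import Defs
import Data.Integer.Base as ℤ
import Data.Nat.Binary.Base as 𝔹
import Data.Nat.Binary.Properties as 𝔹ₚ
import Data.Rational.Base as ℚ
import Data.Rational.Properties as ℚₚ
import Data.Rational.Unnormalised.Base as ℚᵘ
import Data.Rational.Unnormalised.Properties as ℚᵘₚ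

module Strings where

  open import Data.Nat.Base using (_+_; _≤_; _<_; _∸_)
  open import Data.Nat.Properties

  -- Finite strings and cylinders

  infix 4 _≼_

  _≼_ : List Bool → List Bool → Set
  s ≼ t = ∃[ w ] s ++ w ≡ t

  ≼-refl : ∀ {s} → s ≼ s
  ≼-refl {s} = [] , ++-identityʳ s

  ≼-trans : ∀ {s t u} → s ≼ t → t ≼ u → s ≼ u
  ≼-trans {s} (w , refl) (w′ , refl) = w ++ w′ , sym (++-assoc s w w′)

  ≼-length : ∀ {s t} → s ≼ t → length s ≤ length t
  ≼-length {s} (w , refl) = subst (length s ≤_) (sym (length-++ s)) (m≤m+n _ _)

  ≼-equal : ∀ {s t} → s ≼ t → length t ≤ length s → s ≡ t
  ≼-equal {s} ([] , refl)    _  = sym (++-identityʳ s)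
  ≼-equal {s} (b ∷ w , refl) t≤ =
    ⊥-elim (m+1+n≰m (length s) (subst (_≤ length s) (length-++ s) t≤))

  ≼-∷ʳ : ∀ {s} b → s ≼ s ∷ʳ b
  ≼-∷ʳ b = (b ∷ []) , refl

  length-∷ʳ : ∀ s (b : Bool) → length (s ∷ʳ b) ≡ suc (length s)
  length-∷ʳ []      b = refl
  length-∷ʳ (_ ∷ s) b = cong suc (length-∷ʳ s b)

  length-↾ : ∀ (x : Cantor) n → length (x ↾ n) ≡ n
  length-↾ = length-applyUpTo

  ∈N-↾ : ∀ x n → x ∈ N (x ↾ n)
  ∈N-↾ x n = cong (x ↾_) (length-↾ x n)

  N-anti : ∀ {s t} → s ≼ t → N t ⊆ N s
  N-anti {[]}    _          _   = refl
  N-anti {b ∷ s} (w , refl) x∈N with ∷-injective x∈N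
  ... | x0≡b , tail = cong₂ _∷_ x0≡b (N-anti {s} (w , refl) tail)

  ↾-mono-≼ : ∀ x {m n} → m ≤ n → x ↾ m ≼ x ↾ n
  ↾-mono-≼ x {n = n} z≤n = (x ↾ n) , refl
  ↾-mono-≼ x (s≤s m≤n) with ↾-mono-≼ (x ∘ suc) m≤n
  ... | w , eq = w , cong (x 0 ∷_) eq

  ≼-↾ : ∀ {x s n} → x ∈ N s → length s ≤ n → s ≼ x ↾ n
  ≼-↾ {x} {s} {n} x∈s ℓ≤n = subst (_≼ x ↾ n) x∈s (↾-mono-≼ x ℓ≤n)

  ↾-≼ : ∀ {x s n} → x ∈ N s → n ≤ length s → x ↾ n ≼ s
  ↾-≼ {x} {s} {n} x∈s n≤ℓ = subst (x ↾ n ≼_) x∈s (↾-mono-≼ x n≤ℓ)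

  N-comparable : ∀ {x s t} → x ∈ N s → x ∈ N t → length s ≤ length t → s ≼ t
  N-comparable {x} {s} {t} x∈s x∈t ℓ≤ = subst (s ≼_) x∈t (≼-↾ x∈s ℓ≤)

  N-∷ʳ : ∀ {x s} → x ∈ N s → x ∈ N (s ∷ʳ x (length s))
  N-∷ʳ {x} {s} x∈s = begin
    x ↾ length (s ∷ʳ x (length s))  ≡⟨ cong (x ↾_) (length-∷ʳ s _) ⟩
    x ↾ suc (length s)              ≡⟨ applyUpTo-∷ʳ x (length s) ⟨
    (x ↾ length s) ∷ʳ x (length s)  ≡⟨ cong (_∷ʳ x (length s)) x∈s ⟩
    s ∷ʳ x (length s)               ∎
    where open ≡-Reasoning

  N-split : ∀ {x s} → x ∈ N s → x ∈ N (s ∷ʳ true) ⊎ x ∈ N (s ∷ʳ false)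
  N-split {x} {s} x∈s with x (length s) | N-∷ʳ {x} {s} x∈s
  ... | true  | p = inj₁ p
  ... | false | p = inj₂ p

  ≡-↾⇒∈N : ∀ {x y n} → y ↾ n ≡ x ↾ n → y ∈ N (x ↾ n)
  ≡-↾⇒∈N {x} {y} {n} eq = trans (cong (y ↾_) (length-↾ x n)) eq

  ∈N⇒≡-↾ : ∀ {x y n} → y ∈ N (x ↾ n) → y ↾ n ≡ x ↾ n
  ∈N⇒≡-↾ {x} {y} {n} y∈ = trans (cong (y ↾_) (sym (length-↾ x n))) y∈

  ↾-pointwise : ∀ {x y} n → y ↾ n ≡ x ↾ n → ∀ {i} → i < n → y i ≡ x i
  ↾-pointwise (suc n) eq {zero}  _         = proj₁ (∷-injective eq)
  ↾-pointwise (suc n) eq {suc i} (s≤s i<n) = ↾-pointwise n (proj₂ (∷-injective eq)) i<n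

  ↾-≡-anti : ∀ {x y : Cantor} {m n} → m ≤ n → y ↾ n ≡ x ↾ n → y ↾ m ≡ x ↾ m
  ↾-≡-anti z≤n       _  = refl
  ↾-≡-anti (s≤s m≤n) eq with ∷-injective eq
  ... | p , q = cong₂ _∷_ p (↾-≡-anti m≤n q)

  ∉N-open : ∀ s → IsOpen (∁ (N s))
  ∉N-open s {x} x∉s = length s , λ {y} y∈ y∈s → x∉s (trans (sym (∈N⇒≡-↾ {x} {y} {length s} y∈)) y∈s)

  ∩-open : ∀ {U V} → IsOpen U → IsOpen V → IsOpen (U ∩ V)
  ∩-open openU openV {x} (x∈U , x∈V) with openU x∈U | openV x∈V
  ... | m , U⊇ | n , V⊇ = m ⊔ n , λ {y} y∈ →
    U⊇ (N-anti {x ↾ m} (↾-mono-≼ x (m≤m⊔n m n)) {y} y∈) , V⊇ (N-anti {x ↾ n} (↾-mono-≼ x (m≤n⊔m m n)) {y} y∈)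

  -- The default value false is never read below the length.
  nth : List Bool → ℕ → Bool
  nth []      _       = false
  nth (b ∷ s) zero    = b
  nth (b ∷ s) (suc i) = nth s i

  nth-∈N : ∀ s → nth s ∈ N s
  nth-∈N []      = refl
  nth-∈N (b ∷ s) = cong (b ∷_) (nth-∈N s)

  nth-≼ : ∀ {s t} → s ≼ t → ∀ {i} → i < length s → nth s i ≡ nth t i
  nth-≼ {b ∷ s} (w , refl) {zero}  _       = refl
  nth-≼ {b ∷ s} (w , refl) {suc i} (s≤s p) = nth-≼ {s} (w , refl) p

  pointwise-↾ : ∀ {x y : Cantor} n → (∀ {i} → i < n → x i ≡ y i) → x ↾ n ≡ y ↾ n
  pointwise-↾ zero    _  = refl
  pointwise-↾ (suc n) eq = cong₂ _∷_ (eq (s≤s z≤n)) (pointwise-↾ n (eq ∘ s≤s))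

  -- Enumerations

  -- `ℕᵇ` is bijective binary notation: its numerals are exactly the words over two digits, so
  -- reading digits as bits enumerates all strings.
  bits : 𝔹.ℕᵇ → List Bool
  bits 𝔹.zero     = []
  bits 𝔹.2[1+ n ] = true ∷ bits n
  bits 𝔹.1+[2 n ] = false ∷ bits n

  unbits : List Bool → 𝔹.ℕᵇ
  unbits []          = 𝔹.zero
  unbits (true ∷ s)  = 𝔹.2[1+ unbits s ]
  unbits (false ∷ s) = 𝔹.1+[2 unbits s ]

  bits-unbits : ∀ s → bits (unbits s) ≡ s
  bits-unbits []          = refl
  bits-unbits (true ∷ s)  = cong (true ∷_) (bits-unbits s)
  bits-unbits (false ∷ s) = cong (false ∷_) (bits-unbits s)

  string : ℕ → List Bool
  string n = bits (𝔹.fromℕ n)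

  index : List Bool → ℕ
  index s = 𝔹.toℕ (unbits s)

  string-index : ∀ s → string (index s) ≡ s
  string-index s = trans (cong bits (𝔹ₚ.fromℕ-toℕ (unbits s))) (bits-unbits s)

  length≤index : ∀ s → length s ≤ index s
  length≤index []          = z≤n
  length≤index (true ∷ s)  =
    ≤-trans (s≤s (length≤index s)) (m≤m+n (suc (index s)) (suc (index s) + 0))
  length≤index (false ∷ s) = s≤s (≤-trans (length≤index s) (m≤m+n _ _))

  leading : List Bool → ℕ
  leading (true ∷ s) = suc (leading s)
  leading _          = 0

  row : ℕ → ℕ
  row t = leading (string t)

  -- Padding `r` leading trues with `T` falses keeps the row and makes the string long, hence its
  -- index large by `length≤index`.
  row-recurrent : ∀ r T → ∃[ t ] T ≤ t × row t ≡ r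
  row-recurrent r T = index s , ≤-trans T≤ℓ (length≤index s) ,
                      trans (cong leading (string-index s)) (lead r)
    where
    s = replicate r true ++ replicate T false
    lead-false : ∀ T → leading (replicate T false) ≡ 0
    lead-false zero    = refl
    lead-false (suc _) = refl
    lead : ∀ r → leading (replicate r true ++ replicate T false) ≡ r
    lead zero    = lead-false T
    lead (suc r) = cong suc (lead r)
    T≤ℓ : T ≤ length s
    T≤ℓ = subst (T ≤_) (sym (trans (length-++ (replicate r true))
            (cong₂ _+_ (length-replicate r) (length-replicate T)))) (m≤n+m T r)

  _[_]⁺ : (ℕ → ℕ) → ℕ → ℕ → ℕ
  (c [ r ]⁺) i with i ≟ r
  ... | yes _ = suc (c i)
  ... | no  _ = c i

  []⁺-same : ∀ c r → (c [ r ]⁺) r ≡ suc (c r)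
  []⁺-same c r with r ≟ r
  ... | yes _  = refl
  ... | no r≢r = ⊥-elim (r≢r refl)

  []⁺-other : ∀ c {r i} → i ≢ r → (c [ r ]⁺) i ≡ c i
  []⁺-other c {r} {i} i≢r with i ≟ r
  ... | yes i≡r = ⊥-elim (i≢r i≡r)
  ... | no _    = refl

  visits : ℕ → ℕ → ℕ
  visits zero    = λ _ → 0
  visits (suc t) = visits t [ row t ]⁺

  -- ℕ × ℕ is enumerated along the rows: time t is the visit number visits t r
  -- to row r = row t.
  pair : ℕ → ℕ × ℕ
  pair t = row t , visits t (row t)

  -- The search stops at the first time from `t` on in row `r`, before which the visit count cannot
  -- change; `k` only bounds the search.
  next-visit : ∀ r t k → row (t + k) ≡ r → ∃[ t′ ] row t′ ≡ r × visits t′ r ≡ visits t r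
  next-visit r t zero    eq = t , trans (cong row (sym (+-identityʳ t))) eq , refl
  next-visit r t (suc k) eq with r ≟ row t
  ... | yes r≡ = t , sym r≡ , refl
  ... | no r≢ with next-visit r (suc t) k (trans (cong row (sym (+-suc t k))) eq)
  ...   | t′ , p , q = t′ , p , trans q ([]⁺-other (visits t) r≢)

  visits-onto : ∀ r c → ∃[ t ] visits t r ≡ c
  visits-onto r zero    = 0 , refl
  visits-onto r (suc c) with visits-onto r c
  ... | t , eq with row-recurrent r t
  ...   | t₁ , t≤t₁ , row≡ with next-visit r t (t₁ ∸ t) (trans (cong row (m+[n∸m]≡n t≤t₁)) row≡)
  ...     | t′ , refl , q = suc t′ , trans ([]⁺-same (visits t′) (row t′)) (cong suc (trans q eq))

  pair-onto : ∀ p → ∃[ t ] pair t ≡ p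
  pair-onto (r , c) with visits-onto r c
  ... | t , eq with row-recurrent r t
  ...   | t₁ , t≤t₁ , row≡ with next-visit r t (t₁ ∸ t) (trans (cong row (m+[n∸m]≡n t≤t₁)) row≡)
  ...     | t′ , refl , q = t′ , cong (row t′ ,_) (trans q eq)

open Strings

module OuterMeasure where

  open import Data.Rational.Base using (ℚ; mkℚ; 0ℚ; 1ℚ; ½; _+_; _-_; -_; _*_; _<_; _≤_; toℚᵘ; *<*)
  open import Data.Rational.Properties
  open +-*-Solver using (solve; _:=_; _:+_; _:*_; _:-_; con)

  -- Powers of one half

  2^-_ : ℕ → ℚ
  2^- zero  = 1ℚ
  2^- suc k = ½ * 2^- k

  infix 30 2^-_

  μN-length : ∀ s → μN s ≡ 2^- length s
  μN-length []      = refl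
  μN-length (_ ∷ s) = cong (½ *_) (μN-length s)

  2^-double : ∀ k → 2^- suc k + 2^- suc k ≡ 2^- k
  2^-double k = solve 1 (λ p → con ½ :* p :+ con ½ :* p := p) refl (2^- k)

  2^-pos : ∀ k → 0ℚ < 2^- k
  2^-pos zero    = positive⁻¹ 1ℚ
  2^-pos (suc k) = subst (_< 2^- suc k) (*-zeroʳ ½) (*-monoʳ-<-pos ½ (2^-pos k))

  2^-nonneg : ∀ k → 0ℚ ≤ 2^- k
  2^-nonneg k = <⇒≤ (2^-pos k)

  p≤p+q : ∀ {p q} → 0ℚ ≤ q → p ≤ p + q
  p≤p+q {p} {q} 0≤q = subst (_≤ p + q) (+-identityʳ p) (+-monoʳ-≤ p 0≤q)

  p<p+q : ∀ {p q} → 0ℚ < q → p < p + q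
  p<p+q {p} {q} 0<q = subst (_< p + q) (+-identityʳ p) (+-monoʳ-< p 0<q)

  2^-suc : ∀ k → 2^- suc k ≤ 2^- k
  2^-suc k = subst (2^- suc k ≤_) (2^-double k) (p≤p+q (2^-nonneg (suc k)))

  2^-anti : ∀ {m n} → m ℕ.≤ n → 2^- n ≤ 2^- m
  2^-anti {m} {n} m≤n = subst (λ k → 2^- k ≤ 2^- m) (ℕₚ.m∸n+n≡m m≤n) (go (n ℕ.∸ m))
    where
    go : ∀ k → 2^- (k ℕ.+ m) ≤ 2^- m
    go zero    = ℚₚ.≤-refl
    go (suc k) = ℚₚ.≤-trans (2^-suc (k ℕ.+ m)) (go k)

  2^-≤1 : ∀ k → 2^- k ≤ 1ℚ
  2^-≤1 k = 2^-anti {0} {k} z≤n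

  2^-+ : ∀ m n → 2^- (m ℕ.+ n) ≡ 2^- m * 2^- n
  2^-+ zero    n = sym (*-identityˡ (2^- n))
  2^-+ (suc m) n = trans (cong (½ *_) (2^-+ m n)) (sym (*-assoc ½ (2^- m) (2^- n)))

  -- `ℚᵘ.mkℚᵘ (ℤ.+ 1) k` denotes 1/(k+1), as denominators are stored minus one. The induction rests
  -- on k + 2 ≤ 2(k + 1).
  2^-≤1/ : ∀ k → toℚᵘ (2^- k) ℚᵘ.≤ ℚᵘ.mkℚᵘ (ℤ.+ 1) k
  2^-≤1/ zero    = ℚᵘₚ.≤-refl
  2^-≤1/ (suc k) = begin
    toℚᵘ (½ * 2^- k)                    ≃⟨ toℚᵘ-homo-* ½ (2^- k) ⟩
    ℚᵘ.½ ℚᵘ.* toℚᵘ (2^- k)              ≤⟨ ℚᵘₚ.*-monoʳ-≤-nonNeg ℚᵘ.½ (2^-≤1/ k) ⟩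
    ℚᵘ.½ ℚᵘ.* ℚᵘ.mkℚᵘ (ℤ.+ 1) k         ≤⟨ ℚᵘ.*≤* (ℤ.+≤+ k+2≤) ⟩
    ℚᵘ.mkℚᵘ (ℤ.+ 1) (suc k)             ∎
    where
    open ℚᵘₚ.≤-Reasoning
    k+2≤ : suc (suc k) ℕ.+ 0 ℕ.≤ suc (k ℕ.+ suc (k ℕ.+ 0)) ℕ.+ 0
    k+2≤ = ℕₚ.+-monoˡ-≤ 0 (s≤s (subst (ℕ._≤ k ℕ.+ suc (k ℕ.+ 0)) (ℕₚ.+-comm k 1) (ℕₚ.+-monoʳ-≤ k (s≤s z≤n))))

  archimedean : ∀ {q} → 0ℚ < q → ∃[ k ] 2^- k < q
  archimedean {mkℚ (ℤ.+ zero) d _}   (*<* (ℤ.+<+ ()))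
  archimedean {mkℚ (ℤ.-[1+ _ ]) d _} (*<* ())
  -- The fraction is at least 1/(d+1), whereas `2^- suc d` is at most 1/(d+2).
  archimedean {mkℚ (ℤ.+ suc n) d _}  _ = suc d ,
    toℚᵘ-cancel-< (ℚᵘₚ.≤-<-trans (2^-≤1/ (suc d)) (ℚᵘ.*<* (ℤ.+<+
      (ℕₚ.<-≤-trans (s≤s (ℕₚ.≤-reflexive (ℕₚ.+-identityʳ (suc d)))) (m≤m+n (suc (suc d)) _)))))

  gap : ∀ {p q} → p < q → ∃[ k ] p + 2^- k < q
  gap {p} {q} p<q with archimedean {q - p} (subst (_< q - p) (+-inverseʳ p) (+-monoˡ-< (- p) p<q))
  ... | k , lt = k , subst (p + 2^- k <_) (solve 2 (λ p q → p :+ (q :- p) := q) refl p q) (+-monoʳ-< p lt)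

  -- Finite sums

  ∑ : (ℕ → ℚ) → ℕ → ℚ
  ∑ a n = foldr _+_ 0ℚ (applyUpTo a n)

  ∑-suc : ∀ a n → ∑ a (suc n) ≡ ∑ a n + a n
  ∑-suc a zero    = +-comm (a 0) 0ℚ
  ∑-suc a (suc n) = trans (cong (a 0 +_) (∑-suc (a ∘ suc) n)) (sym (+-assoc (a 0) _ _))

  ∑-cong : ∀ {a b} n → (∀ {i} → i ℕ.< n → a i ≡ b i) → ∑ a n ≡ ∑ b n
  ∑-cong zero    eq = refl
  ∑-cong (suc n) eq = cong₂ _+_ (eq (s≤s z≤n)) (∑-cong n (eq ∘ s≤s))

  ∑-mono-≤ : ∀ {a b} → (∀ i → a i ≤ b i) → ∀ n → ∑ a n ≤ ∑ b n
  ∑-mono-≤ a≤b zero    = ℚₚ.≤-refl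
  ∑-mono-≤ a≤b (suc n) = +-mono-≤ (a≤b 0) (∑-mono-≤ (a≤b ∘ suc) n)

  ∑-0 : ∀ n → ∑ (λ _ → 0ℚ) n ≡ 0ℚ
  ∑-0 zero    = refl
  ∑-0 (suc n) = trans (+-identityˡ (∑ (λ _ → 0ℚ) n)) (∑-0 n)

  ∑-+ : ∀ a b n → ∑ (λ i → a i + b i) n ≡ ∑ a n + ∑ b n
  ∑-+ a b zero    = refl
  ∑-+ a b (suc n) = trans (cong (a 0 + b 0 +_) (∑-+ (a ∘ suc) (b ∘ suc) n))
    (solve 4 (λ x y z w → x :+ y :+ (z :+ w) := x :+ z :+ (y :+ w)) refl
      (a 0) (b 0) (∑ (a ∘ suc) n) (∑ (b ∘ suc) n))

  ∑-* : ∀ c a n → ∑ (λ i → c * a i) n ≡ c * ∑ a n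
  ∑-* c a zero    = sym (*-zeroʳ c)
  ∑-* c a (suc n) = trans (cong (c * a 0 +_) (∑-* c (a ∘ suc) n)) (sym (*-distribˡ-+ c (a 0) _))

  ∑-nonneg : ∀ {a} → (∀ i → 0ℚ ≤ a i) → ∀ n → 0ℚ ≤ ∑ a n
  ∑-nonneg {a} a≥0 n = subst (_≤ ∑ a n) (∑-0 n) (∑-mono-≤ a≥0 n)

  ∑-mono-index : ∀ {a} → (∀ i → 0ℚ ≤ a i) → ∀ {m n} → m ℕ.≤ n → ∑ a m ≤ ∑ a n
  ∑-mono-index a≥0 {n = n} z≤n       = ∑-nonneg a≥0 n
  ∑-mono-index {a} a≥0     (s≤s m≤n) = +-monoʳ-≤ (a 0) (∑-mono-index (a≥0 ∘ suc) m≤n)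

  ∑-2^- : ∀ k n → ∑ (λ i → 2^- suc (k ℕ.+ i)) n + 2^- (k ℕ.+ n) ≡ 2^- k
  ∑-2^- k zero    = trans (+-identityˡ _) (cong 2^-_ (ℕₚ.+-identityʳ k))
  ∑-2^- k (suc n) = begin
    ∑ a (suc n) + 2^- (k ℕ.+ suc n)               ≡⟨ cong₂ _+_ (∑-suc a n) (cong 2^-_ (ℕₚ.+-suc k n)) ⟩
    ∑ a n + a n + a n                             ≡⟨ +-assoc (∑ a n) (a n) (a n) ⟩
    ∑ a n + (a n + a n)                           ≡⟨ cong (∑ a n +_) (2^-double (k ℕ.+ n)) ⟩
    ∑ a n + 2^- (k ℕ.+ n)                         ≡⟨ ∑-2^- k n ⟩
    2^- k                                         ∎
    where
    open ≡-Reasoning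
    a = λ i → 2^- suc (k ℕ.+ i)

  ∑-2^-≤ : ∀ k n → ∑ (λ i → 2^- suc (k ℕ.+ i)) n ≤ 2^- k
  ∑-2^-≤ k n = subst (∑ _ n ≤_) (∑-2^- k n) (p≤p+q (2^-nonneg (k ℕ.+ n)))

  ∑-update : ∀ {a b d} r R → r ℕ.< R → b r ≡ a r + d → (∀ {i} → i ≢ r → b i ≡ a i) →
             ∑ b R ≡ ∑ a R + d
  ∑-update {a} {b} {d} r (suc R) r<1+R same other with m≤n⇒m<n∨m≡n (ℕₚ.≤-pred r<1+R)
  ... | inj₂ refl = begin
    ∑ b (suc r)          ≡⟨ ∑-suc b r ⟩
    ∑ b r + b r          ≡⟨ cong₂ _+_ (∑-cong r (other ∘ ℕₚ.<⇒≢)) same ⟩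
    ∑ a r + (a r + d)    ≡⟨ +-assoc (∑ a r) (a r) d ⟨
    ∑ a r + a r + d      ≡⟨ cong (_+ d) (∑-suc a r) ⟨
    ∑ a (suc r) + d      ∎
    where open ≡-Reasoning
  ... | inj₁ r<R = begin
    ∑ b (suc R)          ≡⟨ ∑-suc b R ⟩
    ∑ b R + b R          ≡⟨ cong₂ _+_ (∑-update r R r<R same other) (other (ℕₚ.<⇒≢ r<R ∘ sym)) ⟩
    ∑ a R + d + a R      ≡⟨ solve 3 (λ x y z → x :+ y :+ z := x :+ z :+ y) refl (∑ a R) d (a R) ⟩
    ∑ a R + a R + d      ≡⟨ cong (_+ d) (∑-suc a R) ⟨
    ∑ a (suc R) + d      ∎
    where open ≡-Reasoning

  -- The first `n` terms of the enumeration consist, for each row `r`, of its first `visits n r`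
  -- entries; every further term adds one entry to one row.
  ∑-pair : (a : ℕ → ℕ → ℚ) → ∀ n R → (∀ {t} → t ℕ.< n → row t ℕ.< R) →
           ∑ (λ t → a (row t) (visits t (row t))) n ≡ ∑ (λ r → ∑ (a r) (visits n r)) R
  ∑-pair a zero    R _     = sym (∑-0 R)
  ∑-pair a (suc n) R rows< = begin
    ∑ diag (suc n)
      ≡⟨ ∑-suc diag n ⟩
    ∑ diag n + a (row n) (visits n (row n))
      ≡⟨ cong (_+ a (row n) (visits n (row n))) (∑-pair a n R (rows< ∘ m<n⇒m<1+n)) ⟩
    ∑ (λ r → ∑ (a r) (visits n r)) R + a (row n) (visits n (row n))
      ≡⟨ ∑-update (row n) R (rows< (n<1+n n))
           (trans (cong (∑ (a (row n))) ([]⁺-same (visits n) (row n))) (∑-suc (a (row n)) (visits n (row n))))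
           (λ {i} i≢ → cong (∑ (a i)) ([]⁺-other (visits n) i≢)) ⟨
    ∑ (λ r → ∑ (a r) (visits (suc n) r)) R ∎
    where
    open ≡-Reasoning
    diag : ℕ → ℚ
    diag t = a (row t) (visits t (row t))

  rows-bounded : ∀ n → ∃[ R ] (∀ {t} → t ℕ.< n → row t ℕ.< R)
  rows-bounded zero    = 0 , λ ()
  rows-bounded (suc n) with rows-bounded n
  ... | R , rows< = R ℕ.⊔ suc (row n) , bound
    where
    bound : ∀ {t} → t ℕ.< suc n → row t ℕ.< R ℕ.⊔ suc (row n)
    bound t<1+n with m≤n⇒m<n∨m≡n (ℕₚ.≤-pred t<1+n)
    ... | inj₁ t<n  = ℕₚ.≤-trans (rows< t<n) (m≤m⊔n R _)
    ... | inj₂ refl = m≤n⊔m R _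

  -- Outer measure

  -- A cover is an infinite sequence of nonempty cylinders, so finite covers need padding; these
  -- cylinders together weigh at most `2^- k`.
  filler : ℕ → ℕ → List Bool
  filler k i = replicate (suc (k ℕ.+ i)) false

  ∑-filler : ∀ k n → ∑ (μN ∘ filler k) n ≤ 2^- k
  ∑-filler k n = subst (_≤ 2^- k) (sym (∑-cong n λ {i} _ → weight i)) (∑-2^-≤ k n)
    where
    weight : ∀ i → μN (filler k i) ≡ 2^- suc (k ℕ.+ i)
    weight i = trans (μN-length (filler k i)) (cong 2^-_ (length-replicate (suc (k ℕ.+ i))))

  μ<⇒μ≤ : ∀ {A q} → μ[ A ]< q → ∃[ p ] p < q × μ[ A ]≤ p
  μ<⇒μ≤ (s , cover , r , r<q , bound) = r , r<q , λ r<r′ → s , cover , r , r<r′ , bound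

  μ<-⊆ : ∀ {A B q} → A ⊆ B → μ[ B ]< q → μ[ A ]< q
  μ<-⊆ A⊆B (s , cover , rest) = s , (λ {x} x∈A → cover (A⊆B x∈A)) , rest

  μ<-weaken : ∀ {A p q} → p ≤ q → μ[ A ]< p → μ[ A ]< q
  μ<-weaken p≤q (s , cover , r , r<p , bound) = s , cover , r , <-≤-trans r<p p≤q , bound

  μ≤-⊆ : ∀ {A B q} → A ⊆ B → μ[ B ]≤ q → μ[ A ]≤ q
  μ≤-⊆ {A} {B} A⊆B μB {r} q<r = μ<-⊆ {A} {B} A⊆B (μB q<r)

  μ≤-weaken : ∀ {A p q} → p ≤ q → μ[ A ]≤ p → μ[ A ]≤ q
  μ≤-weaken p≤q μA q<r = μA (≤-<-trans p≤q q<r)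

  μ<⇒pos : ∀ {A q} → μ[ A ]< q → 0ℚ < q
  μ<⇒pos (_ , _ , r , r<q , bound) = ≤-<-trans (bound 0) r<q

  μ≤⇒nonneg : ∀ {A q} → μ[ A ]≤ q → 0ℚ ≤ q
  μ≤⇒nonneg {A} {q} μA = ≮⇒≥ λ q<0 → <-irrefl refl (μ<⇒pos {A} (μA q<0))

  μ∅≤0 : ∀ {A} → (∀ x → x ∉ A) → μ[ A ]≤ 0ℚ
  μ∅≤0 empty {q} 0<q = let k , lt = archimedean 0<q in
    filler k , (λ {x} x∈A → ⊥-elim (empty x x∈A)) , 2^- k , lt , ∑-filler k

  μN≤ : ∀ s → μ[ N s ]≤ μN s
  μN≤ s {q} lt = cover , (λ x∈s → 0 , x∈s) , μN s + 2^- k , proj₂ (gap lt) , bound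
    where
    k : ℕ
    k = proj₁ (gap lt)
    cover : ℕ → List Bool
    cover zero    = s
    cover (suc i) = filler k i
    bound : ∀ n → ∑ (μN ∘ cover) n ≤ μN s + 2^- k
    bound zero    = <⇒≤ (μ<⇒pos {∅} (μ∅≤0 {∅} (λ _ ())
      (subst (λ p → 0ℚ < p + 2^- k) (sym (μN-length s)) (+-mono-< (2^-pos (length s)) (2^-pos k)))))
    bound (suc n) = +-monoʳ-≤ (μN s) (∑-filler k n)

  -- Countable subadditivity: the cover of `A i` may exceed `q i` by 2^-(k+i+1). These errors sum to
  -- at most `2^- k`, which fits between `r` and `r′`. The covers are merged along `pair`.
  μ-⋃ : ∀ (A : ℕ → PointSet) (q : ℕ → ℚ) {r} → (∀ i → μ[ A i ]≤ q i) →
        (∀ n → ∑ q n ≤ r) → μ[ ⋃[ i ∶ ℕ ] A i ]≤ r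
  μ-⋃ A q {r} μA ∑q≤r {r′} r<r′ = cover , covers , r + 2^- k , proj₂ (gap r<r′) , bound
    where
    k : ℕ
    k = proj₁ (gap r<r′)
    q′ : ℕ → ℚ
    q′ i = q i + 2^- suc (k ℕ.+ i)
    cov : ∀ i → μ[ A i ]< q′ i
    cov i = μA i {q′ i} (p<p+q {q i} (2^-pos (suc (k ℕ.+ i))))
    strings : ℕ → ℕ → List Bool
    strings i = proj₁ (cov i)
    cover : ℕ → List Bool
    cover t = strings (row t) (visits t (row t))
    covers : (⋃[ i ∶ ℕ ] A i) ⊆ (⋃[ t ∶ ℕ ] N (cover t))
    covers {x} (i , x∈Ai) = let j , x∈N = proj₁ (proj₂ (cov i)) x∈Ai
                                t , eq  = pair-onto (i , j)
                            in t , subst (λ p → x ∈ N (strings (proj₁ p) (proj₂ p))) (sym eq) x∈N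
    row-bound : ∀ i m → ∑ (μN ∘ strings i) m ≤ q′ i
    row-bound i m = let _ , rᵢ<q , b = proj₂ (proj₂ (cov i)) in ℚₚ.≤-trans (b m) (<⇒≤ rᵢ<q)
    bound : ∀ n → ∑ (μN ∘ cover) n ≤ r + 2^- k
    bound n = let R , rows< = rows-bounded n in begin
      ∑ (μN ∘ cover) n                             ≡⟨ ∑-pair (λ i j → μN (strings i j)) n R rows< ⟩
      ∑ (λ i → ∑ (μN ∘ strings i) (visits n i)) R  ≤⟨ ∑-mono-≤ (λ i → row-bound i (visits n i)) R ⟩
      ∑ q′ R                                       ≡⟨ ∑-+ q _ R ⟩
      ∑ q R + ∑ (λ i → 2^- suc (k ℕ.+ i)) R        ≤⟨ +-mono-≤ (∑q≤r R) (∑-2^-≤ k R) ⟩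
      r + 2^- k                                    ∎
      where open ℚₚ.≤-Reasoning

  μ-∪ : ∀ {A B p q} → μ[ A ]≤ p → μ[ B ]≤ q → μ[ A ∪ B ]≤ (p + q)
  μ-∪ {A} {B} {p} {q} μA μB {r} =
    μ≤-⊆ {A ∪ B} {⋃[ i ∶ ℕ ] seq i} {p + q}
      (λ { (inj₁ x∈A) → 0 , x∈A ; (inj₂ x∈B) → 1 , x∈B })
      (μ-⋃ seq val μseq bound) {r}
    where
    seq : ℕ → PointSet
    seq 0             = A
    seq 1             = B
    seq (suc (suc _)) = ∅
    val : ℕ → ℚ
    val 0             = p
    val 1             = q
    val (suc (suc _)) = 0ℚ
    μseq : ∀ i → μ[ seq i ]≤ val i
    μseq 0             = μA
    μseq 1             = μB
    μseq (suc (suc _)) = μ∅≤0 {∅} (λ _ ())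
    bound : ∀ n → ∑ val n ≤ p + q
    bound 0 = +-mono-≤ (μ≤⇒nonneg {A} μA) (μ≤⇒nonneg {B} μB)
    bound 1 = +-monoʳ-≤ p (μ≤⇒nonneg {B} μB)
    bound (suc (suc n)) = ℚₚ.≤-reflexive (cong (p +_) (trans (cong (q +_) (∑-0 n)) (+-identityʳ q)))

open OuterMeasure

module Hurewicz (em : ExcludedMiddle (lsuc 0ℓ)) where

  open import Data.Nat.Base using (_+_; _≤_; _<_; _∸_)
  open import Data.Nat.Properties

  -- Excluded middle is assumed for all types, not only for propositions, so a
  -- decided Σ-type yields its witness: choice is available throughout.
  em₀ : ∀ {P : Set} → Dec P
  em₀ {P} = map′ lower lift (em {Lift _ P})

  ¬∀⇒∃¬ : ∀ {A : Set} {P : A → Set₁} → ¬ (∀ x → P x) → Σ[ x ∈ A ] ¬ P x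
  ¬∀⇒∃¬ {A} {P} ¬∀ with em {Σ[ x ∈ A ] ¬ P x}
  ... | yes ∃¬ = ∃¬
  ... | no ¬∃¬ = ⊥-elim (¬∀ λ x → decidable-stable em λ ¬Px → ¬∃¬ (x , ¬Px))

  ¬∀⇒∃¬₀ : ∀ {A : Set} {P : A → Set} → ¬ (∀ x → P x) → ∃[ x ] ¬ P x
  ¬∀⇒∃¬₀ {A} {P} ¬∀ with em₀ {∃[ x ] ¬ P x}
  ... | yes ∃¬ = ∃¬
  ... | no ¬∃¬ = ⊥-elim (¬∀ λ x → decidable-stable em₀ λ ¬Px → ¬∃¬ (x , ¬Px))

  Eventually : (ℕ → Set) → Set
  Eventually P = ∃[ T ] (∀ {t} → T ≤ t → P t)

  Frequently : (ℕ → Set) → Set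
  Frequently P = ∀ T → ∃[ t ] T ≤ t × P t

  ¬Eventually⇒Frequently : ∀ {P : ℕ → Set} → ¬ Eventually P → Frequently (λ t → ¬ P t)
  ¬Eventually⇒Frequently {P} ¬ev T with em₀ {∃[ t ] T ≤ t × ¬ P t}
  ... | yes found = found
  ... | no none   = ⊥-elim (¬ev (T , λ {t} T≤t → decidable-stable em₀ λ ¬Pt → none (t , T≤t , ¬Pt)))

  ¬Frequently⇒Eventually : ∀ {P : ℕ → Set} → ¬ Frequently P → Eventually (λ t → ¬ P t)
  ¬Frequently⇒Eventually {P} ¬freq with em₀ {Eventually (λ t → ¬ P t)}
  ... | yes found = found
  ... | no none   = ⊥-elim (¬freq λ T → let t , T≤t , ¬¬Pt = ¬Eventually⇒Frequently none T
                                        in t , T≤t , decidable-stable em₀ ¬¬Pt)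

  -- A complete Π⁰₃ set

  -- The event at time t is a small number only when x t = true, and each small
  -- number is offered at infinitely many times.
  event : Cantor → ℕ → ℕ
  event x t = if x t then row t else t

  𝐗 : PointSet
  𝐗 x = ∀ n → Eventually λ t → n ≤ event x t

  event-cong : ∀ {x y : Cantor} {t} → x t ≡ y t → event x t ≡ event y t
  event-cong {t = t} = cong (λ b → if b then row t else t)

  𝐗-cong : ∀ {x y : Cantor} → (∀ t → x t ≡ y t) → x ∈ 𝐗 → y ∈ 𝐗
  𝐗-cong {x} {y} x≗y x∈𝐗 n with x∈𝐗 n
  ... | T , above = T , λ {t} T≤t → subst (n ≤_) (event-cong {x} {y} (x≗y t)) (above T≤t)

  𝐗∈Π⁰₃ : 𝐗 ∈ Π⁰₃
  𝐗∈Π⁰₃ = (λ n T x → ∀ {t} → T ≤ t → n ≤ event x t) , closed , id , id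
    where
    closed : ∀ n T → IsClosed (λ x → ∀ {t} → T ≤ t → n ≤ event x t)
    closed n T {x} x∉ with ¬∀⇒∃¬₀ {P = λ t → T ≤ t → n ≤ event x t} (λ p → x∉ λ {t} → p t)
    ... | t , ¬above = suc t , λ {y} y∈ above → ¬above λ T≤t →
      subst (n ≤_)
        (event-cong {y} {x} (↾-pointwise {x} {y} (suc t) (∈N⇒≡-↾ {x} {y} {suc t} y∈) ≤-refl))
        (above T≤t)

  uniformly-eventually : ∀ {P : ℕ → ℕ → Set} → (∀ r → Eventually (P r)) →
                         ∀ n → Eventually λ t → ∀ {r} → r < n → P r t
  uniformly-eventually each zero    = 0 , λ _ ()
  uniformly-eventually {P} each (suc n) with uniformly-eventually each n | each n
  ... | T₁ , all< | T₂ , Pn = T₁ ⊔ T₂ , go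
    where
    go : ∀ {t} → T₁ ⊔ T₂ ≤ t → ∀ {r} → r < suc n → P r t
    go T≤t r<1+n with m≤n⇒m<n∨m≡n (≤-pred r<1+n)
    ... | inj₁ r<n  = all< (≤-trans (m≤m⊔n T₁ T₂) T≤t) r<n
    ... | inj₂ refl = Pn (≤-trans (m≤n⊔m T₁ T₂) T≤t)

  -- Reducing a Π⁰₃ set to `𝐗`

  module Completeness (F : ℕ → ℕ → PointSet) (closed : ∀ n m → IsClosed (F n m)) where

    excluded? : List Bool → ℕ → ℕ → Bool
    excluded? s n m = isYes (em₀ {N s ⊆ ∁ (F n m)})

    -- `count y t r` is the current candidate m for y ∈ F r m. When row `r` comes up and the prefix
    -- `y ↾ t` already refutes the candidate, `bit` fires and the next candidate is tried. Thus `y`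
    -- lies in the set exactly when every row fires only finitely often.
    bit : Cantor → ℕ → Bool
    count : Cantor → ℕ → ℕ → ℕ
    bit y t = excluded? (y ↾ t) (row t) (count y t (row t))
    count y zero    = λ _ → 0
    count y (suc t) = if bit y t then count y t [ row t ]⁺ else count y t

    count-local : ∀ {x y : Cantor} t → x ↾ t ≡ y ↾ t → count x t ≡ count y t
    count-local zero    _  = refl
    count-local {x} {y} (suc t) eq =
      cong₂ (λ s c → if excluded? s (row t) (c (row t)) then c [ row t ]⁺ else c)
        (↾-≡-anti {y} {x} {t} (n≤1+n t) eq) (count-local {x} {y} t (↾-≡-anti {y} {x} {t} (n≤1+n t) eq))

    bit-local : ∀ {x y : Cantor} t → x ↾ t ≡ y ↾ t → bit x t ≡ bit y t
    bit-local {x} {y} t eq = cong₂ (λ s c → excluded? s (row t) (c (row t))) eq (count-local {x} {y} t eq)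

    code : List Bool → Bool
    code s = bit (nth s) (length s)

    code-bit : ∀ y t → code (y ↾ t) ≡ bit y t
    code-bit y t = trans (cong (bit (nth (y ↾ t))) (length-↾ y t))
      (bit-local {nth (y ↾ t)} {y} t (∈N⇒≡-↾ {y} {nth (y ↾ t)} {t} (nth-∈N (y ↾ t))))

    count-hit : ∀ {y t r} → row t ≡ r → bit y t ≡ true → count y (suc t) r ≡ suc (count y t r)
    count-hit {y} {t} refl hit rewrite hit = []⁺-same (count y t) (row t)

    count-miss : ∀ {y t r} → ¬ (row t ≡ r × bit y t ≡ true) → count y (suc t) r ≡ count y t r
    count-miss {y} {t} miss with bit y t
    ... | false = refl
    ... | true  = []⁺-other (count y t) λ { refl → miss (refl , refl) }

    count-mono : ∀ {y r} t → count y t r ≤ count y (suc t) r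
    count-mono {y} {r} t with em₀ {row t ≡ r × bit y t ≡ true}
    ... | yes (row≡ , hit) = ≤-trans (n≤1+n _) (≤-reflexive (sym (count-hit row≡ hit)))
    ... | no miss          = ≤-reflexive (sym (count-miss miss))

    -- A correct candidate is never refuted, so the count cannot pass it.
    count-bounded : ∀ {y r m} → y ∈ F r m → ∀ t → count y t r ≤ m
    count-bounded y∈F zero = z≤n
    count-bounded {y} {r} {m} y∈F (suc t) with em₀ {row t ≡ r × bit y t ≡ true}
    ... | no miss = ≤-trans (≤-reflexive (count-miss miss)) (count-bounded y∈F t)
    ... | yes (refl , hit) = ≤-trans (≤-reflexive (count-hit refl hit))
        (≤∧≢⇒< (count-bounded y∈F t) λ eq → not-excluded (subst (λ c → y ∈ F (row t) c) (sym eq) y∈F) hit)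
      where
      not-excluded : y ∈ F (row t) (count y t (row t)) → bit y t ≢ true
      not-excluded y∈ hit with em₀ {N (y ↾ t) ⊆ ∁ (F (row t) (count y t (row t)))}
      ... | yes disjoint = disjoint {y} (∈N-↾ y t) y∈
      not-excluded y∈ () | no _

    count-unbounded : ∀ {y r} → Frequently (λ t → row t ≡ r × bit y t ≡ true) →
                      ∀ c → ∃[ t ] c ≤ count y t r
    count-unbounded freq zero    = 0 , z≤n
    count-unbounded {y} {r} freq (suc c) with count-unbounded freq c
    ... | t , c≤ with freq t
    ...   | t′ , t≤t′ , row≡ , hit = suc t′ ,
      ≤-trans (s≤s (≤-trans c≤ (mono t≤t′))) (≤-reflexive (sym (count-hit row≡ hit)))
      where
      mono : ∀ {m n} → m ≤ n → count y m r ≤ count y n r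
      mono {m} {n} m≤n = subst (λ k → count y m r ≤ count y k r) (m∸n+n≡m m≤n) (go (n ∸ m))
        where
        go : ∀ k → count y m r ≤ count y (k + m) r
        go zero    = ≤-refl
        go (suc k) = ≤-trans (go k) (count-mono (k + m))

    count-constant : ∀ {y r T} → (∀ {t} → T ≤ t → ¬ (row t ≡ r × bit y t ≡ true)) →
                     ∀ k → count y (k + T) r ≡ count y T r
    count-constant miss zero            = refl
    count-constant {T = T} miss (suc k) =
      trans (count-miss (miss (m≤n+m T k))) (count-constant miss k)

    ∈⇒bits∈𝐗 : ∀ {y} → y ∈ ⋂[ n ∶ ℕ ] ⋃[ m ∶ ℕ ] F n m → bit y ∈ 𝐗
    ∈⇒bits∈𝐗 {y} y∈ n with uniformly-eventually {λ r t → ¬ (row t ≡ r × bit y t ≡ true)} quiet n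
      where
      quiet : ∀ r → Eventually λ t → ¬ (row t ≡ r × bit y t ≡ true)
      quiet r = ¬Frequently⇒Eventually λ freq → let m , y∈F = y∈ r
                                                    t , m<  = count-unbounded freq (suc m)
                                                in <-irrefl refl (≤-trans m< (count-bounded y∈F t))
    -- Besides the silence of all rows below `n`, the default event value `t` must have reached `n`.
    ... | T , quiet = T ⊔ n , go
      where
      go : ∀ {t} → T ⊔ n ≤ t → n ≤ event (bit y) t
      go {t} T≤t with bit y t in eq
      ... | false = ≤-trans (m≤n⊔m T n) T≤t
      ... | true  = ≮⇒≥ λ row<n → quiet (≤-trans (m≤m⊔n T n) T≤t) row<n (refl , eq)

    -- If row `r` fires finitely often, its candidate settles at some `c`. Were `y` outside the
    -- closed set `F r c`, a prefix would refute `c`, and a later visit to row `r` would fire.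
    bits∈𝐗⇒∈ : ∀ {y} → bit y ∈ 𝐗 → y ∈ ⋂[ n ∶ ℕ ] ⋃[ m ∶ ℕ ] F n m
    bits∈𝐗⇒∈ {y} bits∈𝐗 r = decidable-stable em₀ λ none →
      let
        T , above     = bits∈𝐗 (suc r)
        quiet : ∀ {t} → T ≤ t → ¬ (row t ≡ r × bit y t ≡ true)
        quiet {t} = λ { T≤t (refl , hit) →
          <-irrefl refl (subst (row t <_) (cong (if_then row t else t) hit) (above T≤t)) }
        c             = count y T r
        n , disjoint  = closed r c {y} (λ y∈F → none (c , y∈F))
        t , T⊔n≤t , row≡ = row-recurrent r (T ⊔ n)
        T≤t           = ≤-trans (m≤m⊔n T n) T⊔n≤t
        count≡        = trans (cong (λ k → count y k r) (sym (m∸n+n≡m T≤t))) (count-constant quiet (t ∸ T))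
      in quiet T≤t (row≡ , hit row≡ count≡ λ {x} x∈ →
           disjoint (N-anti {y ↾ n} (↾-mono-≼ y (≤-trans (m≤n⊔m T n) T⊔n≤t)) {x} x∈))
      where
      hit : ∀ {t r c} → row t ≡ r → count y t r ≡ c → N (y ↾ t) ⊆ ∁ (F r c) → bit y t ≡ true
      hit {t} refl refl disjoint with em₀ {N (y ↾ t) ⊆ ∁ (F (row t) (count y t (row t)))}
      ... | yes _ = refl
      ... | no ¬d = ⊥-elim (¬d disjoint)

  -- Output bit `t` depends on the first `t` input bits only, not on input bit `t`. This strictness
  -- goes beyond continuity and makes fixed points available.
  Π⁰₃⇒contracting : ∀ {Y} → Y ∈ Π⁰₃ → Σ[ h ∈ (List Bool → Bool) ]
                    (∀ y → (y ∈ Y → (λ t → h (y ↾ t)) ∈ 𝐗) × ((λ t → h (y ↾ t)) ∈ 𝐗 → y ∈ Y))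
  Π⁰₃⇒contracting (F , closed , Y⊆ , ⊆Y) = code , λ y →
      (λ y∈Y → 𝐗-cong (sym ∘ code-bit y) (∈⇒bits∈𝐗 (Y⊆ y∈Y)))
    , (λ code∈ → ⊆Y (bits∈𝐗⇒∈ {y} (𝐗-cong (code-bit y) code∈)))
    where open Completeness F closed

  Π⁰₃⇒≤W𝐗 : ∀ {Y} → Y ∈ Π⁰₃ → Y ≤W 𝐗
  Π⁰₃⇒≤W𝐗 {Y} Y∈Π⁰₃ with Π⁰₃⇒contracting Y∈Π⁰₃
  ... | h , reduces = f , continuous , (λ {y} → proj₁ (reduces y)) , (λ {y} → proj₂ (reduces y))
    where
    f : Cantor → Cantor
    f y t = h (y ↾ t)
    continuous : Continuous f
    continuous x n = n , λ {y} y∈ → ≡-↾⇒∈N {f x} {f y} {n} (pointwise-↾ n λ {i} i<n →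
      cong h (↾-≡-anti {x} {y} {i} (<⇒≤ i<n) (∈N⇒≡-↾ {x} {y} {n} y∈)))

  -- `𝐗` is not Σ⁰₃

  fixed-point : (h : List Bool → Bool) → Σ[ x ∈ Cantor ] (∀ n → x n ≡ h (x ↾ n))
  fixed-point h = h ∘ w , λ n → cong h (sym (w-↾ n))
    where
    w : ℕ → List Bool
    w zero    = []
    w (suc n) = w n ∷ʳ h (w n)
    w-↾ : ∀ n → (h ∘ w) ↾ n ≡ w n
    w-↾ zero    = refl
    w-↾ (suc n) = trans (sym (applyUpTo-∷ʳ (h ∘ w) n)) (cong (_∷ʳ h (w n)) (w-↾ n))

  ∁-Σ⁰₃ : ∀ {A} → A ∈ Σ⁰₃ → ∁ A ∈ Π⁰₃
  ∁-Σ⁰₃ {A} (G , open-G , A⊆ , ⊆A) = (λ n m → ∁ (G n m)) , closed , to , from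
    where
    closed : ∀ n m → IsClosed (∁ (G n m))
    closed n m {x} ¬x∉ with open-G n m (decidable-stable em₀ ¬x∉)
    ... | k , ⊆G = k , λ y∈ y∉ → y∉ (⊆G y∈)
    to : ∁ A ⊆ ⋂[ n ∶ ℕ ] ⋃[ m ∶ ℕ ] ∁ (G n m)
    to {x} x∉A n = ¬∀⇒∃¬₀ λ x∈G → x∉A (⊆A (n , x∈G))
    from : (⋂[ n ∶ ℕ ] ⋃[ m ∶ ℕ ] ∁ (G n m)) ⊆ ∁ A
    from {x} x∈ x∈A with A⊆ x∈A
    ... | n , x∈G with x∈ n
    ...   | m , x∉G = x∉G (x∈G m)

  -- A Σ⁰₃ definition of 𝐗 would reduce the complement of 𝐗 to 𝐗 by a
  -- contraction, whose fixed point is both in and outside 𝐗.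
  𝐗∉Σ⁰₃ : 𝐗 ∉ Σ⁰₃
  𝐗∉Σ⁰₃ 𝐗∈Σ⁰₃ with Π⁰₃⇒contracting (∁-Σ⁰₃ 𝐗∈Σ⁰₃)
  ... | h , reduces with fixed-point h
  ...   | x , fixed = x∉𝐗 (𝐗-cong (sym ∘ fixed) (proj₁ (reduces x) x∉𝐗))
    where
    x∉𝐗 : x ∉ 𝐗
    x∉𝐗 x∈𝐗 = proj₂ (reduces x) (𝐗-cong fixed x∈𝐗) x∈𝐗

  -- Building reductions of 𝐗 from event-driven processes

  -- The common skeleton of both reductions: an event `e` acts at level `e ⊓ depth`, after which the
  -- depth is one more than that level, while the strings only grow and converge to `limit`.
  module Process {ℓ} (State : Set ℓ) (init : State) (depth : State → ℕ) (str : State → List Bool)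
    (step : State → ℕ → State)
    (depth-step : ∀ σ e → depth (step σ e) ≡ suc (e ⊓ depth σ))
    (str-step : ∀ σ e → str σ ≼ str (step σ e))
    (length-step : ∀ σ e → length (str σ) < length (str (step σ e)))
    where

    run : Cantor → ℕ → State
    run x zero    = init
    run x (suc t) = step (run x t) (event x t)

    level : Cantor → ℕ → ℕ
    level x t = event x t ⊓ depth (run x t)

    limit : Cantor → Cantor
    -- After `suc i` steps the string has length at least `suc i`, so position `i` holds a genuine
    -- bit.
    limit x i = nth (str (run x (suc i))) i

    str-length : ∀ x t → t ≤ length (str (run x t))
    str-length x zero    = z≤n
    str-length x (suc t) = ≤-trans (s≤s (str-length x t)) (length-step (run x t) (event x t))

    str-mono : ∀ x {m n} → m ≤ n → str (run x m) ≼ str (run x n)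
    str-mono x {m} {n} m≤n = subst (λ k → str (run x m) ≼ str (run x k)) (m∸n+n≡m m≤n) (go (n ∸ m))
      where
      go : ∀ k → str (run x m) ≼ str (run x (k + m))
      go zero    = ≼-refl
      go (suc k) = ≼-trans (go k) (str-step (run x (k + m)) (event x (k + m)))

    limit∈N : ∀ x t → limit x ∈ N (str (run x t))
    limit∈N x t = trans (pointwise-↾ (length s) agree) (nth-∈N s)
      where
      s = str (run x t)
      agree : ∀ {i} → i < length s → limit x i ≡ nth s i
      agree {i} i<ℓ with ≤-total (suc i) t
      ... | inj₁ i<t = nth-≼ (str-mono x i<t) (str-length x (suc i))
      ... | inj₂ t≤i = sym (nth-≼ (str-mono x t≤i) i<ℓ)

    run-local : ∀ {x y} t → y ↾ t ≡ x ↾ t → run y t ≡ run x t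
    run-local zero    _  = refl
    run-local {x} {y} (suc t) eq = cong₂ step (run-local {x} {y} t (↾-≡-anti {x} {y} (n≤1+n t) eq))
      (event-cong {y} {x} (↾-pointwise {x} {y} (suc t) eq ≤-refl))

    limit-continuous : Continuous limit
    limit-continuous x n = n , λ {y} y∈ → ≡-↾⇒∈N {limit x} {limit y} {n} (pointwise-↾ n λ {i} i<n →
      cong (λ σ → nth (str σ) i) (run-local {x} {y} (suc i) (↾-≡-anti {x} {y} i<n (∈N⇒≡-↾ {x} {y} {n} y∈))))

    -- The level is capped by the depth, so large events alone do not suffice. But once levels stay
    -- at or above `n`, all later depths exceed `n`, and the cap rises with the induction.
    level→∞ : ∀ {x} → x ∈ 𝐗 → ∀ n → Eventually λ t → n ≤ level x t
    level→∞ x∈𝐗 zero = 0 , λ _ → z≤n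
    level→∞ {x} x∈𝐗 (suc n) with level→∞ x∈𝐗 n | x∈𝐗 (suc n)
    ... | T₁ , n≤level | T₂ , n<event = suc T₁ ⊔ T₂ , λ T≤t →
        ⊓-glb (n<event (≤-trans (m≤n⊔m (suc T₁) T₂) T≤t)) (n<depth (≤-trans (m≤m⊔n (suc T₁) T₂) T≤t))
      where
      n<depth : ∀ {t} → T₁ < t → n < depth (run x t)
      n<depth {suc t} (s≤s T₁≤t) =
        subst (n <_) (sym (depth-step (run x t) (event x t))) (s≤s (n≤level T₁≤t))

    level-frequently : ∀ {x} → x ∉ 𝐗 → ∃[ n ] Frequently (λ t → level x t < n)
    level-frequently {x} x∉𝐗 with ¬∀⇒∃¬₀ x∉𝐗
    ... | n , ¬ev = n , λ T → let t , T≤t , n≰ = ¬Eventually⇒Frequently ¬ev T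
                              in t , T≤t , ≤-<-trans (m⊓n≤m (event x t) _) (≰⇒> n≰)

    -- Lowering the bound as long as levels below it recur ends at the least recurring level, below
    -- which levels eventually never fall.
    liminf : ∀ {x} n → Frequently (λ t → level x t < n) →
             ∃[ m ] Eventually (λ t → m ≤ level x t) × Frequently (λ t → level x t ≡ m)
    liminf zero    freq with () ← proj₂ (proj₂ (freq 0))
    liminf {x} (suc n) freq with em₀ {Frequently (λ t → level x t < n)}
    ... | yes freq′ = liminf n freq′
    ... | no ¬freq with ¬Frequently⇒Eventually ¬freq
    ...   | T₀ , ≮n = n , (T₀ , ≮⇒≥ ∘ ≮n) , λ T →
      let t , T≤t , level≤n = freq (T ⊔ T₀)
      in t , ≤-trans (m≤m⊔n T T₀) T≤t , ≤-antisym (≤-pred level≤n) (≮⇒≥ (≮n (≤-trans (m≤n⊔m T T₀) T≤t)))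

  -- Closed sets

  N-closed : ∀ s → IsClosed (N s)
  N-closed = ∉N-open

  ∩-closed : ∀ {C D} → IsClosed C → IsClosed D → IsClosed (C ∩ D)
  ∩-closed {C} {D} closedC closedD {x} x∉ with em₀ {x ∈ C}
  ... | no x∉C  = let n , disjoint = closedC x∉C in n , λ y∈ (y∈C , _) → disjoint y∈ y∈C
  ... | yes x∈C = let n , disjoint = closedD (λ x∈D → x∉ (x∈C , x∈D))
                  in n , λ y∈ (_ , y∈D) → disjoint y∈ y∈D

  ∅-closed : IsClosed ∅
  ∅-closed _ = 0 , λ _ ()

  -- Open neighbourhoods of `C` that shrink to it when `C` is closed; they present closed sets as
  -- G_δ sets.
  hull : PointSet → ℕ → PointSet
  hull C n x = N (x ↾ n) ≬ C

  hull-open : ∀ C n → IsOpen (hull C n)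
  hull-open C n {x} meets = n , λ {y} y∈ → subst (λ s → N s ≬ C) (sym (∈N⇒≡-↾ {x} {y} {n} y∈)) meets

  ⊆hull : ∀ {C} n → C ⊆ hull C n
  ⊆hull n {x} x∈C = x , ∈N-↾ x n , x∈C

  ⋂hull⊆ : ∀ {C} → IsClosed C → (⋂[ n ∶ ℕ ] hull C n) ⊆ C
  ⋂hull⊆ {C} closed {x} x∈ = decidable-stable em₀ λ x∉C →
    let n , disjoint = closed x∉C ; y , y∈N , y∈C = x∈ n in disjoint {y} y∈N y∈C

  splice : ∀ {a} {A : Set a} → ℕ → (ℕ → A) → A → ℕ → A
  splice n f a i with i ≤? n
  ... | yes _ = f i
  ... | no _  = a

  splice-old : ∀ {a} {A : Set a} n (f : ℕ → A) a {i} → i ≤ n → splice n f a i ≡ f i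
  splice-old n f a {i} i≤n with i ≤? n
  ... | yes _  = refl
  ... | no i≰n = ⊥-elim (i≰n i≤n)

  splice-new : ∀ {a} {A : Set a} n (f : ℕ → A) a → splice n f a (suc n) ≡ a
  splice-new n f a with suc n ≤? n
  ... | yes n<n = ⊥-elim (<-irrefl refl n<n)
  ... | no _    = refl

  splice-chain : ∀ {a} {A : Set a} (R : ℕ → A → A → Set) n (f : ℕ → A) a →
                 (∀ {i} → i < n → R i (f i) (f (suc i))) → R n (f n) a →
                 ∀ {i} → i < suc n → R i (splice n f a i) (splice n f a (suc i))
  splice-chain R n f a old new {i} i<1+n with m≤n⇒m<n∨m≡n (≤-pred i<1+n)
  ... | inj₁ i<n  = subst₂ (R i) (sym (splice-old n f a (<⇒≤ i<n))) (sym (splice-old n f a i<n)) (old i<n)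
  ... | inj₂ refl = subst₂ (R n) (sym (splice-old n f a ≤-refl)) (sym (splice-new n f a)) new

  -- Wadge-hardness of Π⁰₃ sets that are not Σ⁰₃

  module Hardness {Y : PointSet} (F : ℕ → ℕ → PointSet) (F-closed : ∀ n m → IsClosed (F n m))
    (Y⊆ : Y ⊆ ⋂[ n ∶ ℕ ] ⋃[ m ∶ ℕ ] F n m) (⊆Y : (⋂[ n ∶ ℕ ] ⋃[ m ∶ ℕ ] F n m) ⊆ Y) where

    -- Separated sets and countable gluing

    Sep : PointSet → Set₁
    Sep D = Σ[ G ∈ (ℕ → ℕ → PointSet) ] (∀ n m → IsOpen (G n m)) ×
      (∀ x → x ∈ D → x ∈ Y → x ∈ ⋃[ n ∶ ℕ ] ⋂[ m ∶ ℕ ] G n m) ×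
      (∀ x → x ∈ D → x ∈ ⋃[ n ∶ ℕ ] ⋂[ m ∶ ℕ ] G n m → x ∈ Y)

    Sep-∅ : Sep ∅
    Sep-∅ = (λ _ _ → ∅) , (λ _ _ ()) , (λ _ ()) , (λ _ ())

    -- The hulls turn each closed `P i` into a G_δ set, so the Σ⁰₃ definitions on the pieces unite
    -- into a single one; the extra G_δ set given by `G` takes index 0.
    Sep-σ : ∀ {D} (P : ℕ → PointSet) → (∀ i → IsClosed (P i)) → (∀ i → Sep (P i)) →
            (G : ℕ → PointSet) → (∀ m → IsOpen (G m)) →
            (∀ x → x ∈ D → x ∈ Y → x ∈ ⋃[ i ∶ ℕ ] P i ⊎ x ∈ ⋂[ m ∶ ℕ ] G m) →
            (∀ x → x ∈ D → x ∈ ⋂[ m ∶ ℕ ] G m → x ∈ Y) → Sep D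
    Sep-σ {D} P P-closed P-sep G G-open covers G⊆Y = H , H-open , to , from
      where
      H : ℕ → ℕ → PointSet
      H zero    m = G m
      H (suc t) m = let i , n = pair t in proj₁ (P-sep i) n m ∩ hull (P i) m
      H-open : ∀ t m → IsOpen (H t m)
      H-open zero    m = G-open m
      H-open (suc t) m = let i , n = pair t in
        ∩-open (proj₁ (proj₂ (P-sep i)) n m) (hull-open (P i) m)
      to : ∀ x → x ∈ D → x ∈ Y → x ∈ ⋃[ t ∶ ℕ ] ⋂[ m ∶ ℕ ] H t m
      to x x∈D x∈Y with covers x x∈D x∈Y
      ... | inj₂ x∈G = 0 , x∈G
      ... | inj₁ (i , x∈P) with proj₁ (proj₂ (proj₂ (P-sep i))) x x∈P x∈Y
      ...   | n , x∈S with pair-onto (i , n)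
      ...     | t , eq = suc t , λ m →
        subst (λ p → x ∈ proj₁ (P-sep (proj₁ p)) (proj₂ p) m ∩ hull (P (proj₁ p)) m) (sym eq)
          (x∈S m , ⊆hull m x∈P)
      from : ∀ x → x ∈ D → x ∈ ⋃[ t ∶ ℕ ] ⋂[ m ∶ ℕ ] H t m → x ∈ Y
      from x x∈D (zero  , x∈G) = G⊆Y x x∈D x∈G
      from x x∈D (suc t , x∈H) = let i , n = pair t in
        proj₂ (proj₂ (proj₂ (P-sep i))) x (⋂hull⊆ (P-closed i) (proj₂ ∘ x∈H)) (n , proj₁ ∘ x∈H)

    -- For fixed `n` the sets `F n m` cover `Y`. If all pieces `D ∩ F n m` were separated, gluing
    -- them with an empty G_δ set would separate `D`.
    ¬Sep-∩F : ∀ {D} → IsClosed D → ¬ Sep D → ∀ n → Σ[ m ∈ ℕ ] ¬ Sep (D ∩ F n m)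
    ¬Sep-∩F {D} D-closed ¬sep n = ¬∀⇒∃¬ λ all-sep → ¬sep
      (Sep-σ (λ m → D ∩ F n m) (λ m → ∩-closed D-closed (F-closed n m)) all-sep
         (λ _ → ∅) (λ _ ())
         (λ x x∈D x∈Y → let m , x∈F = Y⊆ x∈Y n in inj₁ (m , x∈D , x∈F))
         (λ x _ x∈∅ → ⊥-elim (x∈∅ 0)))

    -- A piece contained in some F k j misses the G_δ set ⋂ⱼ ∁ (F k j), the k-th
    -- part of the complement of Y.
    Thin : ℕ → PointSet → Set₁
    Thin k E = Σ[ P ∈ (ℕ → PointSet) ] (∀ i → IsClosed (P i)) ×
      (∀ i → Sep (P i) ⊎ (∃[ j ] P i ⊆ F k j)) × E ⊆ ⋃[ i ∶ ℕ ] P i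

    Thin-closed : ∀ {k P} → IsClosed P → Sep P ⊎ (∃[ j ] P ⊆ F k j) → Thin k P
    Thin-closed {P = P} closed kind = (λ _ → P) , (λ _ → closed) , (λ _ → kind) , λ x∈P → 0 , x∈P

    Thin-σ : ∀ {k D} (E : ℕ → PointSet) → (∀ i → Thin k (E i)) → D ⊆ ⋃[ i ∶ ℕ ] E i → Thin k D
    Thin-σ {k} {D} E thin D⊆ =
        (λ t → let i , n = pair t in proj₁ (thin i) n)
      , (λ t → let i , n = pair t in proj₁ (proj₂ (thin i)) n)
      , (λ t → let i , n = pair t in proj₁ (proj₂ (proj₂ (thin i))) n)
      , covers
      where
      covers : D ⊆ ⋃[ t ∶ ℕ ] (let i , n = pair t in proj₁ (thin i) n)
      covers {x} x∈D with D⊆ x∈D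
      ... | i , x∈E with proj₂ (proj₂ (proj₂ (thin i))) x∈E
      ...   | n , x∈P with pair-onto (i , n)
      ...     | t , eq = t , subst (λ p → x ∈ proj₁ (thin (proj₁ p)) (proj₂ p)) (sym eq) x∈P

    Thin-∪ : ∀ {k D E E′} → Thin k E → Thin k E′ → D ⊆ E ∪ E′ → Thin k D
    Thin-∪ {k} {D} {E} {E′} thin thin′ D⊆ = Thin-σ seq seq-thin λ x∈D → index-of (D⊆ x∈D)
      where
      seq : ℕ → PointSet
      seq zero    = E
      seq (suc _) = E′
      seq-thin : ∀ i → Thin k (seq i)
      seq-thin zero    = thin
      seq-thin (suc _) = thin′
      index-of : E ∪ E′ ⊆ ⋃[ i ∶ ℕ ] seq i
      index-of (inj₁ x∈E)  = 0 , x∈E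
      index-of (inj₂ x∈E′) = 1 , x∈E′

    -- Lets a union over the strings satisfying a condition run over all of `ℕ`: an index that fails
    -- it contributes only empty pieces.
    Thin-guard : ∀ {k} {Q : Set} {E} → (Q → Thin k E) → Thin k (λ x → Q × x ∈ E)
    Thin-guard {Q = Q} thin with em₀ {Q}
    ... | yes q = let P , closed , kind , E⊆ = thin q in P , closed , kind , λ (_ , x∈E) → E⊆ x∈E
    ... | no ¬q = let P , closed , kind , _ = Thin-closed ∅-closed (inj₁ Sep-∅)
                  in P , closed , kind , λ (q , _) → ⊥-elim (¬q q)

    -- `Thin` lives in `Set₁`; passing through its decision brings it down to `Set`, so that
    -- `thinPart` is a `PointSet`.
    ThinAt : ℕ → PointSet → List Bool → Set
    ThinAt k D s = True (em {Thin k (N s ∩ D)})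

    thinPart : ℕ → PointSet → PointSet
    thinPart k D x = ∃[ s ] ThinAt k D s × x ∈ N s

    thinPart-open : ∀ k D → IsOpen (thinPart k D)
    thinPart-open k D {x} (s , thin , x∈s) = length s , λ {y} y∈ →
      s , thin , trans (∈N⇒≡-↾ {x} {y} {length s} y∈) x∈s

    Thin-thinPart : ∀ k D → Thin k (D ∩ thinPart k D)
    Thin-thinPart k D = Thin-σ (λ t x → ThinAt k D (string t) × x ∈ N (string t) ∩ D)
      (λ t → Thin-guard toWitness)
      λ {x} (x∈D , s , thin , x∈s) →
        index s , subst (λ s → ThinAt k D s × x ∈ N s ∩ D) (sym (string-index s)) (thin , x∈s , x∈D)

    -- The analogue of a perfect kernel, with thin pieces in place of countable ones.
    core : ℕ → PointSet → PointSet
    core k D = D ∩ ∁ (thinPart k D)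

    core-closed : ∀ k {D} → IsClosed D → IsClosed (core k D)
    core-closed k {D} D-closed = ∩-closed D-closed λ {x} ¬¬x∈ →
      let n , ⊆thin = thinPart-open k D (decidable-stable em₀ ¬¬x∈)
      in n , λ y∈ y∉ → y∉ (⊆thin y∈)

    Avoids : ℕ → ℕ → List Bool → Set
    Avoids k j s = ∀ {i} → i ≤ j → N s ⊆ ∁ (F k i)

    Rich : ℕ → PointSet → Set₁
    Rich k C = ∀ {s} → N s ≬ C → ∀ j → Σ[ s′ ∈ List Bool ] s ≼ s′ × Avoids k j s′ × ¬ Sep (N s′ ∩ C)

    Avoids-≼ : ∀ {k j s s′} → s ≼ s′ → Avoids k j s → Avoids k j s′
    Avoids-≼ {s = s} s≼s′ avoids i≤j {x} x∈s′ = avoids i≤j (N-anti {s} s≼s′ x∈s′)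

    avoiding-prefix : ∀ {x k} → (∀ i → x ∉ F k i) → ∀ j → ∃[ n ] Avoids k j (x ↾ n)
    avoiding-prefix {x} {k} x∉ zero = let n , disjoint = F-closed k 0 (x∉ 0) in
      n , λ { z≤n {y} y∈ → disjoint {y} y∈ }
    avoiding-prefix {x} {k} x∉ (suc j) with avoiding-prefix {x} {k} x∉ j | F-closed k (suc j) (x∉ (suc j))
    ... | m , avoids | n , disjoint = m ⊔ n , go
      where
      go : Avoids k (suc j) (x ↾ (m ⊔ n))
      go i≤1+j {y} y∈ with m≤n⇒m<n∨m≡n i≤1+j
      ... | inj₁ i≤j  = avoids (≤-pred i≤j) {y} (N-anti {x ↾ m} (↾-mono-≼ x (m≤m⊔n m n)) {y} y∈)
      ... | inj₂ refl = disjoint {y} (N-anti {x ↾ n} (↾-mono-≼ x (m≤n⊔m m n)) {y} y∈)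

    -- If no such extension existed, every point of `N s ∩ C` would lie in some `F k i` or in a
    -- cylinder on which `C` is separated. Both parts are thin, and so is the part of `D` outside
    -- `C`. Hence `N s ∩ D` would be thin, and `N s` would already have been removed from the core.
    core-rich : ∀ k {D} → IsClosed D → Rich k (core k D)
    core-rich k {D} D-closed {s} (x₀ , x₀∈s , x₀∈D , x₀∉thin) j
      with em {Σ[ s′ ∈ List Bool ] s ≼ s′ × Avoids k j s′ × ¬ Sep (N s′ ∩ core k D)}
    ... | yes found = found
    ... | no none   = ⊥-elim (x₀∉thin (s , fromWitness thin , x₀∈s))
      where
      C = core k D
      Good : List Bool → Set
      Good s′ = s ≼ s′ × Avoids k j s′
      thin-F : Thin k (N s ∩ C ∩ ⋃[ i ∶ ℕ ] F k i)
      thin-F = Thin-σ (λ i → N s ∩ C ∩ F k i)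
        (λ i → Thin-closed (∩-closed (N-closed s) (∩-closed (core-closed k D-closed) (F-closed k i)))
                           (inj₂ (i , λ (_ , _ , x∈F) → x∈F)))
        λ (x∈s , x∈C , i , x∈F) → i , x∈s , x∈C , x∈F
      thin-good : Thin k (C ∩ ⋃[ s′ ∶ List Bool ] (λ x → Good s′ × x ∈ N s′))
      thin-good = Thin-σ (λ t x → Good (string t) × x ∈ N (string t) ∩ C)
        (λ t → Thin-guard λ (s≼ , avoids) →
          Thin-closed (∩-closed (N-closed (string t)) (core-closed k D-closed))
                      (inj₁ (decidable-stable em λ ¬sep → none (string t , s≼ , avoids , ¬sep))))
        λ {x} (x∈C , s′ , good , x∈s′) →
          index s′ , subst (λ s′ → Good s′ × x ∈ N s′ ∩ C) (sym (string-index s′)) (good , x∈s′ , x∈C)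
      split : N s ∩ C ⊆ (N s ∩ C ∩ ⋃[ i ∶ ℕ ] F k i) ∪ (C ∩ ⋃[ s′ ∶ List Bool ] (λ x → Good s′ × x ∈ N s′))
      split {x} (x∈s , x∈C) with em₀ {∃[ i ] x ∈ F k i}
      ... | yes x∈F = inj₁ (x∈s , x∈C , x∈F)
      ... | no x∉F with avoiding-prefix {x} {k} (λ i x∈F → x∉F (i , x∈F)) j
      ...   | n , avoids = inj₂ (x∈C , x ↾ (length s ⊔ n) ,
        (≼-↾ x∈s (m≤m⊔n (length s) n) ,
         Avoids-≼ {k} {j} {x ↾ n} (↾-mono-≼ x (m≤n⊔m (length s) n)) avoids) ,
        ∈N-↾ x (length s ⊔ n))
      thin : Thin k (N s ∩ D)
      thin = Thin-∪ (Thin-thinPart k D) (Thin-∪ thin-F thin-good split) cover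
        where
        cover : N s ∩ D ⊆ (D ∩ thinPart k D) ∪ (N s ∩ C)
        cover {x} (x∈s , x∈D) with em₀ {x ∈ thinPart k D}
        ... | yes x∈thin = inj₁ (x∈D , x∈thin)
        ... | no x∉thin  = inj₂ (x∈s , x∈D , x∉thin)

    -- If D is thin for every k, then every point of D outside Y lies in one of
    -- the pieces on which Y is Σ⁰₃, and the points of D outside all these pieces
    -- form a G_δ subset of Y.
    Thin⇒Sep : ∀ {D} → (∀ k → Thin k D) → Sep D
    Thin⇒Sep {D} thin = Sep-σ P P-closed P-sep (∁ ∘ P) P-closed
        (λ x _ _ → split x)
        λ x x∈D x∉P → ⊆Y λ k → decidable-stable em₀ λ x∉F → missed x x∈D k (λ i x∈F → x∉F (i , x∈F)) x∉P
      where
      part : ∀ {A B} → Sep A ⊎ B → PointSet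
      part {A} (inj₁ _) = A
      part     (inj₂ _) = ∅
      part-closed : ∀ {A B} → IsClosed A → (kind : Sep A ⊎ B) → IsClosed (part kind)
      part-closed closed (inj₁ _) = closed
      part-closed closed (inj₂ _) = ∅-closed
      part-sep : ∀ {A B} (kind : Sep A ⊎ B) → Sep (part kind)
      part-sep (inj₁ sep) = sep
      part-sep (inj₂ _)   = Sep-∅
      kind : ∀ p → let k , i = p in Sep (proj₁ (thin k) i) ⊎ (∃[ j ] proj₁ (thin k) i ⊆ F k j)
      kind (k , i) = proj₁ (proj₂ (proj₂ (thin k))) i
      P : ℕ → PointSet
      P t = part (kind (pair t))
      P-closed : ∀ t → IsClosed (P t)
      P-closed t = part-closed (proj₁ (proj₂ (thin (row t))) (visits t (row t))) (kind (pair t))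
      P-sep : ∀ t → Sep (P t)
      P-sep t = part-sep (kind (pair t))
      split : ∀ x → x ∈ ⋃[ t ∶ ℕ ] P t ⊎ x ∈ ⋂[ t ∶ ℕ ] ∁ (P t)
      split x with em₀ {∃[ t ] x ∈ P t}
      ... | yes x∈P = inj₁ x∈P
      ... | no x∉P  = inj₂ λ t x∈Pt → x∉P (t , x∈Pt)
      in-part : ∀ {x k A} → x ∈ A → (∀ i → x ∉ F k i) → (kind : Sep A ⊎ (∃[ j ] A ⊆ F k j)) → x ∈ part kind
      in-part x∈A x∉F (inj₁ _)         = x∈A
      in-part x∈A x∉F (inj₂ (j , A⊆F)) = ⊥-elim (x∉F j (A⊆F x∈A))
      missed : ∀ x → x ∈ D → ∀ k → (∀ i → x ∉ F k i) → ¬ (x ∈ ⋂[ t ∶ ℕ ] ∁ (P t))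
      missed x x∈D k x∉F x∉P with proj₂ (proj₂ (proj₂ (thin k))) x∈D
      ... | i , x∈piece with pair-onto (k , i)
      ...   | t , eq = x∉P t (subst (λ p → x ∈ part (kind p)) (sym eq)
                         (in-part x∈piece x∉F (kind (k , i))))

    -- Layers and the nested construction

    record Layer : Set₁ where
      field
        rank   : ℕ
        set    : PointSet
        closed : IsClosed set
        rich   : Rich rank set

    open Layer

    -- By `Thin⇒Sep` there is a `k` for which `D` is not thin. The core for this `k` is nonempty,
    -- since otherwise `D` would be contained in its thin part.
    refine : ∀ {D} → IsClosed D → ¬ Sep D → Σ[ ℓ ∈ Layer ] set ℓ ⊆ D × (∃[ x ] x ∈ set ℓ)
    refine {D} D-closed ¬sep with ¬∀⇒∃¬ {P = λ k → Thin k D} (¬sep ∘ Thin⇒Sep)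
    ... | k , ¬thin with em₀ {∃[ x ] x ∈ core k D}
    ...   | yes nonempty = record
              { rank = k ; set = core k D ; closed = core-closed k D-closed ; rich = core-rich k D-closed }
            , proj₁ , nonempty
    ...   | no empty = ⊥-elim (¬thin (let P , P-closed , kind , covers = Thin-thinPart k D in
              P , P-closed , kind , λ {x} x∈D → covers
                (x∈D , decidable-stable em₀ λ x∉ → empty (x , x∈D , x∉))))

    -- `level` is constrained only up to `depth`; its later values are arbitrary.
    record State : Set₁ where
      field
        depth  : ℕ
        level  : ℕ → Layer
        str    : List Bool
        meets  : N str ≬ set (level depth)
        nested : ∀ {i} → i < depth → set (level (suc i)) ⊆ set (level i)
        within : ∀ {i} → i < depth → ∃[ m ] set (level (suc i)) ⊆ F i m

      nested* : ∀ {n} → n ≤ depth → set (level depth) ⊆ set (level n)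
      nested* {n} n≤d = go depth ≤-refl n≤d
        where
        go : ∀ d → d ≤ depth → n ≤ d → set (level d) ⊆ set (level n)
        go d d≤ n≤d with m≤n⇒m<n∨m≡n n≤d
        go d       d≤ _ | inj₂ refl      = id
        go (suc d) d≤ _ | inj₁ (s≤s n≤d) = go d (<⇒≤ d≤) n≤d ∘ nested d≤

    open State using (depth; str; nested*; within)

    record Next (σ : State) (n : ℕ) : Set₁ where
      field
        state  : State
        deeper : depth state ≡ suc n
        longer : str σ ≼ str state
        strict : length (str σ) < length (str state)
        keeps  : ∀ {i} → i ≤ n → State.level state i ≡ State.level σ i
        -- The stage is the current length, so infinitely many events at one unchanged layer avoid
        -- every `F k i` for its rank k.
        avoids : Avoids (rank (State.level σ n)) (length (str σ)) (str state)

    open Next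

    record Advance (n : ℕ) (ℓ : Layer) (s : List Bool) : Set₁ where
      field
        string⁺  : List Bool
        longer⁺  : s ≼ string⁺
        strict⁺  : length s < length string⁺
        avoids⁺  : Avoids (rank ℓ) (length s) string⁺
        layer⁺   : Layer
        meets⁺   : N string⁺ ≬ set layer⁺
        nested⁺  : set layer⁺ ⊆ set ℓ
        within⁺  : ∃[ m ] set layer⁺ ⊆ F n m

    open Advance

    -- Richness enters the required stage and `¬Sep-∩F` chooses `m`; both keep the closed set
    -- non-separated, which is what `refine` needs to produce the next layer.
    advance : ∀ n ℓ {s} → N s ≬ set ℓ → Advance n ℓ s
    advance n ℓ {s} meets =
      let s′ , s≼s′ , avoiding , ¬sep = rich ℓ meets (length s)
          D-closed                    = ∩-closed (N-closed s′) (closed ℓ)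
          m , ¬sep′                   = ¬Sep-∩F D-closed ¬sep n
          ℓ′ , ℓ′⊆ , x , x∈ℓ′         = refine (∩-closed D-closed (F-closed n m)) ¬sep′
      in assemble s′ s≼s′ avoiding ℓ′ m ℓ′⊆ x x∈ℓ′
      where
      assemble : ∀ s′ → s ≼ s′ → Avoids (rank ℓ) (length s) s′ → ∀ ℓ′ m →
                 set ℓ′ ⊆ (N s′ ∩ set ℓ) ∩ F n m → ∀ x → x ∈ set ℓ′ → Advance n ℓ s
      assemble s′ s≼s′ avoiding ℓ′ m ℓ′⊆ x x∈ℓ′ = record
        -- One bit beyond `s′`, taken along a point of the new layer, gives strict growth even if
        -- `s′` equals `s`.
        { string⁺ = x ↾ suc (length s′)
        ; longer⁺ = ≼-trans s≼s′ s′≼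
        ; strict⁺ = subst (length s <_) (sym (length-↾ x (suc (length s′)))) (s≤s (≼-length s≼s′))
        ; avoids⁺ = Avoids-≼ {s = s′} s′≼ avoiding
        ; layer⁺  = ℓ′
        ; meets⁺  = x , ∈N-↾ x (suc (length s′)) , x∈ℓ′
        ; nested⁺ = λ y∈ → proj₂ (proj₁ (ℓ′⊆ y∈))
        ; within⁺ = m , λ y∈ → proj₂ (ℓ′⊆ y∈)
        }
        where
        s′≼ : s′ ≼ x ↾ suc (length s′)
        s′≼ = ≼-↾ (proj₁ (proj₁ (ℓ′⊆ x∈ℓ′))) (n≤1+n _)

    abstract
      next : ∀ σ n → n ≤ depth σ → Next σ n
      next σ n n≤d = assemble (advance n (State.level σ n) meets)
        where
        meets : N (str σ) ≬ set (State.level σ n)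
        meets = let x , x∈s , x∈ = State.meets σ in x , x∈s , nested* σ n≤d x∈
        assemble : Advance n (State.level σ n) (str σ) → Next σ n
        assemble a = record
          { state = record
              { depth  = suc n
              ; level  = splice n (State.level σ) (layer⁺ a)
              ; str    = string⁺ a
              ; meets  = subst (λ ℓ → N (string⁺ a) ≬ set ℓ)
                           (sym (splice-new n (State.level σ) (layer⁺ a))) (meets⁺ a)
              ; nested = splice-chain (λ _ ℓ₁ ℓ₂ → set ℓ₂ ⊆ set ℓ₁) n (State.level σ) (layer⁺ a)
                           (λ i<n → State.nested σ (≤-trans i<n n≤d)) (nested⁺ a)
              ; within = splice-chain (λ i _ ℓ → ∃[ m ] set ℓ ⊆ F i m) n (State.level σ) (layer⁺ a)
                           (λ i<n → within σ (≤-trans i<n n≤d)) (within⁺ a)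
              }
          ; deeper = refl
          ; longer = longer⁺ a
          ; strict = strict⁺ a
          ; keeps  = splice-old n (State.level σ) (layer⁺ a)
          ; avoids = avoids⁺ a
          }

    module Reduction (init : State) where

      step : State → ℕ → State
      step σ e = state (next σ (e ⊓ depth σ) (m⊓n≤n e (depth σ)))

      nextOf : ∀ σ e → Next σ (e ⊓ depth σ)
      nextOf σ e = next σ (e ⊓ depth σ) (m⊓n≤n e (depth σ))

      open Process State init depth str step
        (λ σ e → deeper (nextOf σ e)) (λ σ e → longer (nextOf σ e)) (λ σ e → strict (nextOf σ e))

      layerAt : Cantor → ℕ → ℕ → Layer
      layerAt x t = State.level (run x t)

      stable : ∀ {x n T} → (∀ {t} → T ≤ t → n ≤ level x t) → ∀ {t} → T ≤ t → layerAt x t n ≡ layerAt x T n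
      stable {x} {n} {T} above {t} T≤t =
        subst (λ t → layerAt x t n ≡ layerAt x T n) (m∸n+n≡m T≤t) (go (t ∸ T))
        where
        go : ∀ k → layerAt x (k + T) n ≡ layerAt x T n
        go zero    = refl
        go (suc k) = trans (keeps (nextOf (run x (k + T)) (event x (k + T))) (above (m≤n+m T k))) (go k)

      -- Once all levels exceed `n`, layer `suc n` no longer changes. It is closed and meets every
      -- cylinder built later, so it contains the limit, and `within` places it inside some `F n m`.
      ∈𝐗⇒limit∈F : ∀ {x} → x ∈ 𝐗 → ∀ n → ∃[ m ] limit x ∈ F n m
      ∈𝐗⇒limit∈F {x} x∈𝐗 n = proj₁ small , proj₂ small lim∈ℓ
        where
        T = proj₁ (level→∞ x∈𝐗 (suc n))
        above : ∀ {t} → T ≤ t → suc n ≤ level x t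
        above = proj₂ (level→∞ x∈𝐗 (suc n))
        ℓ : Layer
        ℓ = layerAt x (suc T) (suc n)
        deep : ∀ {t} → T < t → suc n < depth (run x t)
        deep {suc t} (s≤s T≤t) =
          subst (suc n <_) (sym (deeper (nextOf (run x t) (event x t)))) (s≤s (above T≤t))
        small : ∃[ m ] set ℓ ⊆ F n m
        small = within (run x (suc T)) (<-trans (n<1+n n) (deep ≤-refl))
        meets-ℓ : ∀ {t} → T < t → N (str (run x t)) ≬ set ℓ
        meets-ℓ {t} T<t = let y , y∈s , y∈ = State.meets (run x t) in
          y , y∈s , subst (λ ℓ → y ∈ set ℓ) (stable {x} {suc n} {suc T} (λ T<t → above (<⇒≤ T<t)) T<t)
                      (nested* (run x t) (<⇒≤ (deep T<t)) y∈)
        lim∈ℓ : limit x ∈ set ℓ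
        lim∈ℓ = decidable-stable em₀ λ lim∉ →
          let j , disjoint = closed ℓ {limit x} lim∉
              y , y∈s , y∈ℓ = meets-ℓ {suc T ⊔ j} (m≤m⊔n (suc T) j)
              j≤ℓ = ≤-trans (m≤n⊔m (suc T) j) (str-length x (suc T ⊔ j))
          in disjoint {y} (N-anti {limit x ↾ j} (↾-≼ {limit x} (limit∈N x (suc T ⊔ j)) j≤ℓ) {y} y∈s) y∈ℓ

      -- Otherwise let `n` be the liminf of the levels. Layer `n` freezes with some rank k, and the
      -- limit, being in `Y`, lies in some `F k i`. But a late event at level `n` avoids `F k i`,
      -- since the string is at least as long as the time.
      limit∈Y⇒∈𝐗 : ∀ {x} → limit x ∈ Y → x ∈ 𝐗
      limit∈Y⇒∈𝐗 {x} lim∈Y = decidable-stable em₀ λ x∉𝐗 →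
        let n₀ , freq₀ = level-frequently x∉𝐗
            n , (T , above) , freq = liminf n₀ freq₀
        in missed n T above freq
        where
        missed : ∀ n T → (∀ {t} → T ≤ t → n ≤ level x t) → Frequently (λ t → level x t ≡ n) → ⊥
        missed n T above freq =
          let i , lim∈F = Y⊆ lim∈Y (rank (layerAt x T n))
              t , T⊔i≤t , level≡n = freq (T ⊔ i)
          in avoided t level≡n (≤-trans (m≤m⊔n T i) T⊔i≤t)
               (≤-trans (m≤n⊔m T i) (≤-trans T⊔i≤t (str-length x t)))
               {limit x} (limit∈N x (suc t)) lim∈F
          where
          avoided : ∀ t → level x t ≡ n → T ≤ t →
                    Avoids (rank (layerAt x T n)) (length (str (run x t))) (str (run x (suc t)))
          avoided t level≡n T≤t =
            subst (λ k → Avoids k (length (str (run x t))) (str (run x (suc t))))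
              (cong rank (trans (cong (layerAt x t) level≡n) (stable above T≤t)))
              (avoids (nextOf (run x t) (event x t)))

      reduction : 𝐗 ≤W Y
      reduction = limit , limit-continuous , (λ x∈𝐗 → ⊆Y (∈𝐗⇒limit∈F x∈𝐗)) , limit∈Y⇒∈𝐗

    ¬Σ⁰₃⇒𝐗≤W : Y ∉ Σ⁰₃ → 𝐗 ≤W Y
    ¬Σ⁰₃⇒𝐗≤W Y∉Σ⁰₃ =
      let ℓ , _ , x , x∈ℓ = refine {λ _ → ⊤} (λ x∉ → ⊥-elim (x∉ tt)) ¬sep
      in Reduction.reduction record
        { depth = 0 ; level = λ _ → ℓ ; str = [] ; meets = x , refl , x∈ℓ
        ; nested = λ () ; within = λ () }
      where
      ¬sep : ¬ Sep (λ _ → ⊤)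
      ¬sep (G , open-G , to , from) = Y∉Σ⁰₃ (G , open-G , (λ {x} → to x tt) , (λ {x} → from x tt))

module DensityPoints (em : ExcludedMiddle (lsuc 0ℓ)) where

  open import Data.Rational.Base using (ℚ; 0ℚ; 1ℚ; ½; _+_; _-_; -_; _*_; _<_; _≤_; nonNegative)
  open import Data.Rational.Properties
  open +-*-Solver using (solve; _:=_; _:+_; _:*_; _:-_; con)
  open Hurewicz em

  -- Density at a finite stage

  θ : ℕ → List Bool → ℚ
  θ k s = (1ℚ - 2^- k) * μN s

  μN-pos : ∀ s → 0ℚ < μN s
  μN-pos s = subst (0ℚ <_) (sym (μN-length s)) (2^-pos (length s))

  μN-∷ʳ : ∀ s b → μN (s ∷ʳ b) ≡ ½ * μN s
  μN-∷ʳ s b = trans (μN-length (s ∷ʳ b)) (trans (cong 2^-_ (length-∷ʳ s b)) (cong (½ *_) (sym (μN-length s))))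

  μN-split : ∀ s → μN (s ∷ʳ true) + μN (s ∷ʳ false) ≡ μN s
  μN-split s = trans (cong₂ _+_ (μN-∷ʳ s true) (μN-∷ʳ s false))
    (solve 1 (λ p → con ½ :* p :+ con ½ :* p := p) refl (μN s))

  μN-anti : ∀ {s t} → length s ℕ.≤ length t → μN t ≤ μN s
  μN-anti {s} {t} ℓ≤ = subst₂ _≤_ (sym (μN-length t)) (sym (μN-length s)) (2^-anti ℓ≤)

  *-monoˡ : ∀ {p q r} → 0ℚ ≤ r → p ≤ q → r * p ≤ r * q
  *-monoˡ {r = r} 0≤r = *-monoˡ-≤-nonNeg r {{nonNegative 0≤r}}

  *-monoʳ : ∀ {p q r} → 0ℚ ≤ r → p ≤ q → p * r ≤ q * r
  *-monoʳ {r = r} 0≤r = *-monoʳ-≤-nonNeg r {{nonNegative 0≤r}}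

  1-2^-nonneg : ∀ k → 0ℚ ≤ 1ℚ - 2^- k
  1-2^-nonneg k = subst (_≤ 1ℚ - 2^- k) (+-inverseʳ (2^- k)) (+-monoˡ-≤ (- 2^- k) (2^-≤1 k))

  1-2^-pos : ∀ k → 0ℚ < 1ℚ - 2^- suc k
  1-2^-pos k = subst (_< 1ℚ - 2^- suc k) (+-inverseʳ (2^- suc k)) (+-monoˡ-< (- 2^- suc k)
    (ℚₚ.<-≤-trans (subst (2^- suc k <_) (2^-double k) (p<p+q (2^-pos (suc k)))) (2^-≤1 k)))

  θ-pos : ∀ k s → 0ℚ < θ (suc k) s
  θ-pos k s = subst (_< θ (suc k) s) (*-zeroˡ (μN s))
    (*-monoˡ-<-pos (μN s) {{ℚ.positive (μN-pos s)}} (1-2^-pos k))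

  1-anti : ∀ {p q} → p ≤ q → 1ℚ - q ≤ 1ℚ - p
  1-anti p≤q = +-monoʳ-≤ 1ℚ (neg-antimono-≤ p≤q)

  θ-mono : ∀ {k l} s → k ℕ.≤ l → θ k s ≤ θ l s
  θ-mono s k≤l = *-monoʳ (<⇒≤ (μN-pos s)) (1-anti (2^-anti k≤l))

  θ-≼ : ∀ k {s t} → length s ℕ.≤ length t → θ k t ≤ θ k s
  θ-≼ k {s} {t} ℓ≤ = *-monoˡ (1-2^-nonneg k) (μN-anti {s} {t} ℓ≤)

  μ-∪-< : ∀ {A B p q} → μ[ A ]< p → μ[ B ]≤ q → μ[ A ∪ B ]< (p + q)
  μ-∪-< {A} {B} {p} {q} μA μB = let p′ , p′<p , μA′ = μ<⇒μ≤ {A} μA in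
    μ-∪ {A} {B} μA′ μB (+-monoˡ-< q p′<p)

  μ≤1 : ∀ A → μ[ A ]≤ 1ℚ
  μ≤1 A {q} = μ≤-⊆ {A} {N []} (λ _ → refl) (μN≤ []) {q}

  -- Replacing each cylinder N u of a cover of A by A ∩ N u would otherwise
  -- shrink every cover by a fixed amount.
  lebesgue : ∀ {A} j → μ[ A ]≥ (2^- j) → ∀ M → ∃[ u ] μ[ A ∩ N u ]≥ θ M u
  lebesgue {A} j large M = decidable-stable em₀ λ none → large
      (shrink-1 none (2^-pos j))
    where
    c = 1ℚ - 2^- M
    Shrinks : ℚ → Set
    Shrinks d = ∀ {p} → μ[ A ]≤ p → μ[ A ]≤ (p - d)
    module _ (none : ¬ (∃[ u ] μ[ A ∩ N u ]≥ θ M u)) where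
      thin : ∀ u → μ[ A ∩ N u ]≤ θ M u
      thin u θ<r = μ<-weaken {A ∩ N u} (<⇒≤ θ<r) (decidable-stable em₀ λ ¬μ → none (u , ¬μ))
      shrink : Shrinks (2^- (M ℕ.+ j))
      shrink {p} μA {q} p-d<q = shrunk (μA p<q+d)
        where
        -- Every cover of `A` weighs at least `2^- j`, so the factor 1 - 2^-M saves at least this
        -- much.
        d = 2^- (M ℕ.+ j)
        p<q+d : p < q + d
        p<q+d = subst (_< q + d) (solve 2 (λ p d → p :- d :+ d := p) refl p d) (+-monoˡ-< d p-d<q)
        shrunk : μ[ A ]< (q + d) → μ[ A ]< q
        shrunk (s , cover , r , r<q+d , bound) = μA≤cr cr<q
          where
          μA≤cr : μ[ A ]≤ (c * r)
          μA≤cr {r′} = μ≤-⊆ {A} {⋃[ i ∶ ℕ ] (A ∩ N (s i))}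
            (λ {x} x∈A → let i , x∈N = cover x∈A in i , x∈A , x∈N)
            (μ-⋃ (λ i → A ∩ N (s i)) (λ i → c * μN (s i)) (λ i → thin (s i))
              (λ n → subst (_≤ c * r) (sym (∑-* c (μN ∘ s) n)) (*-monoˡ (1-2^-nonneg M) (bound n)))) {r′}
          2^-j≤r : 2^- j ≤ r
          2^-j≤r = ≮⇒≥ λ r<2^-j → large (s , cover , r , r<2^-j , bound)
          cr<q : c * r < q
          cr<q = begin-strict
            (1ℚ - 2^- M) * r         ≡⟨ solve 2 (λ h r → (con 1ℚ :- h) :* r := r :- h :* r) refl (2^- M) r ⟩
            r - 2^- M * r            ≤⟨ +-monoʳ-≤ r (neg-antimono-≤ (*-monoˡ (2^-nonneg M) 2^-j≤r)) ⟩
            r - 2^- M * 2^- j        ≡⟨ cong (λ d → r - d) (2^-+ M j) ⟨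
            r - d                    <⟨ +-monoˡ-< (- d) r<q+d ⟩
            q + d - d                ≡⟨ solve 2 (λ q d → q :+ d :- d := q) refl q d ⟩
            q                        ∎
            where open ℚₚ.≤-Reasoning
      -- Applying a decrease twice doubles it; once it has grown to 1 it exhausts the bound `μ≤1`.
      shrinks : ∀ k → Shrinks (2^- k) → Shrinks 1ℚ
      shrinks zero    sh = sh
      shrinks (suc k) sh = shrinks k λ {p} μA → subst (λ q → μ[ A ]≤ q)
        (trans (solve 2 (λ p d → p :- d :- d := p :- (d :+ d)) refl p (2^- suc k))
          (cong (λ d → p - d) (2^-double k)))
        (sh {p - 2^- suc k} (sh {p} μA))
      shrink-1 : μ[ A ]≤ 0ℚ
      shrink-1 = subst (λ q → μ[ A ]≤ q) (+-inverseʳ 1ℚ) (shrinks (M ℕ.+ j) shrink {1ℚ} (μ≤1 A))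

  select : ∀ {P : Set} → Dec P → ℚ → ℚ → ℚ
  select (yes _) a b = a
  select (no _)  a b = b

  module Density (B : PointSet) where

    infix 4 _⊩_

    _⊩_ : ℕ → List Bool → Set
    k ⊩ s = μ[ B ∩ N s ]≥ θ k s

    ⊩-anti : ∀ {k l s} → k ℕ.≤ l → l ⊩ s → k ⊩ s
    ⊩-anti {s = s} k≤l dense μ< = dense (μ<-weaken {B ∩ N s} (θ-mono s k≤l) μ<)

    -- The defect 1 - μ(B ∩ N s) / μ(N s) at most doubles from s to s ∷ʳ b.
    ⊩-∷ʳ : ∀ {k s} b → suc k ⊩ s → k ⊩ s ∷ʳ b
    ⊩-∷ʳ {k} {s} b dense μ< = dense (subst (λ q → μ[ B ∩ N s ]< q) total
      (μ<-⊆ {B ∩ N s} {(B ∩ N (s ∷ʳ b)) ∪ N (s ∷ʳ not b)} (λ {x} → split b {x})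
        (μ-∪-< {B ∩ N (s ∷ʳ b)} {N (s ∷ʳ not b)} μ< (μN≤ (s ∷ʳ not b)))))
      where
      split : ∀ b → (B ∩ N s) ⊆ (B ∩ N (s ∷ʳ b)) ∪ N (s ∷ʳ not b)
      split b {x} (x∈B , x∈s) with N-split {x} {s} x∈s
      split true  (x∈B , _) | inj₁ x∈ = inj₁ (x∈B , x∈)
      split true  (x∈B , _) | inj₂ x∈ = inj₂ x∈
      split false (x∈B , _) | inj₁ x∈ = inj₂ x∈
      split false (x∈B , _) | inj₂ x∈ = inj₁ (x∈B , x∈)
      total : θ k (s ∷ʳ b) + μN (s ∷ʳ not b) ≡ θ (suc k) s
      total = trans (cong₂ (λ p q → (1ℚ - 2^- k) * p + q) (μN-∷ʳ s b) (μN-∷ʳ s (not b)))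
        (solve 2 (λ h m → (con 1ℚ :- h) :* (con ½ :* m) :+ con ½ :* m := (con 1ℚ :- con ½ :* h) :* m) refl
          (2^- k) (μN s))

    -- A maximal inequality

    module FirstFailure (k : ℕ) where

      -- The failing prefix lies `L` bits below `v` and is the first one from `v` on; `weight` is
      -- the total measure of the cylinders of these failing strings.
      FirstFailure : List Bool → ℕ → PointSet
      FirstFailure v zero    x = x ∈ B ∩ N v × ¬ k ⊩ v
      FirstFailure v (suc L) x = k ⊩ v × (x ∈ FirstFailure (v ∷ʳ true) L ∪ FirstFailure (v ∷ʳ false) L)

      weight : List Bool → ℕ → ℚ
      weight v zero    = select (em₀ {k ⊩ v}) 0ℚ (μN v)
      weight v (suc L) = select (em₀ {k ⊩ v}) (weight (v ∷ʳ true) L + weight (v ∷ʳ false) L) 0ℚ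

      c : ℚ
      c = 1ℚ - 2^- k

      μ-FirstFailure : ∀ v L → μ[ FirstFailure v L ]≤ (c * weight v L)
      μ-FirstFailure v zero = go em₀
        where
        go : (d : Dec (k ⊩ v)) → μ[ FirstFailure v zero ]≤ (c * select d 0ℚ (μN v))
        go (yes dense) = subst (λ q → μ[ FirstFailure v zero ]≤ q) (sym (*-zeroʳ c))
          (μ∅≤0 {FirstFailure v zero} λ _ (_ , fails) → fails dense)
        go (no fails) θ<q = μ<-⊆ {FirstFailure v zero} {B ∩ N v} proj₁
          (μ<-weaken {B ∩ N v} (<⇒≤ θ<q) (decidable-stable em₀ fails))
      μ-FirstFailure v (suc L) = go em₀
        where
        v₁ = v ∷ʳ true
        v₂ = v ∷ʳ false
        go : (d : Dec (k ⊩ v)) → μ[ FirstFailure v (suc L) ]≤ (c * select d (weight v₁ L + weight v₂ L) 0ℚ)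
        go (yes _) {q} = μ≤-⊆ {FirstFailure v (suc L)} {FirstFailure v₁ L ∪ FirstFailure v₂ L} proj₂
          (subst (λ q → μ[ FirstFailure v₁ L ∪ FirstFailure v₂ L ]≤ q)
            (sym (*-distribˡ-+ c (weight v₁ L) (weight v₂ L)))
            (μ-∪ {FirstFailure v₁ L} {FirstFailure v₂ L} (μ-FirstFailure v₁ L) (μ-FirstFailure v₂ L))) {q}
        go (no fails) = subst (λ q → μ[ FirstFailure v (suc L) ]≤ q) (sym (*-zeroʳ c))
          (μ∅≤0 {FirstFailure v (suc L)} λ _ (dense , _) → fails dense)

      -- The first failures below `v` form an antichain, so their cylinders are disjoint.
      ∑-weight : ∀ n v → ∑ (weight v) n ≤ μN v
      ∑-weight zero    v = <⇒≤ (μN-pos v)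
      ∑-weight (suc n) v = go em₀
        where
        v₁ = v ∷ʳ true
        v₂ = v ∷ʳ false
        go : (d : Dec (k ⊩ v)) →
             select d 0ℚ (μN v) + ∑ (λ L → select d (weight v₁ L + weight v₂ L) 0ℚ) n ≤ μN v
        go (yes _) = begin
          0ℚ + ∑ (λ L → weight v₁ L + weight v₂ L) n  ≡⟨ +-identityˡ (∑ (λ L → weight v₁ L + weight v₂ L) n) ⟩
          ∑ (λ L → weight v₁ L + weight v₂ L) n       ≡⟨ ∑-+ (weight v₁) (weight v₂) n ⟩
          ∑ (weight v₁) n + ∑ (weight v₂) n           ≤⟨ +-mono-≤ (∑-weight n v₁) (∑-weight n v₂) ⟩
          μN v₁ + μN v₂                               ≡⟨ μN-split v ⟩
          μN v                                        ∎
          where open ℚₚ.≤-Reasoning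
        go (no _) = ℚₚ.≤-reflexive (trans (cong (μN v +_) (∑-0 n)) (+-identityʳ (μN v)))

      μ-⋃FirstFailure : ∀ v → μ[ ⋃[ L ∶ ℕ ] FirstFailure v L ]≤ θ k v
      μ-⋃FirstFailure v = μ-⋃ (FirstFailure v) (λ L → c * weight v L) (μ-FirstFailure v) λ n →
        subst (_≤ θ k v) (sym (∑-* c (weight v) n)) (*-monoˡ (1-2^-nonneg k) (∑-weight n v))

      failure⇒first : ∀ {x} d v → x ∈ B → x ∈ N v → ¬ k ⊩ (x ↾ (d ℕ.+ length v)) → ∃[ L ] x ∈ FirstFailure v L
      failure⇒first {x} d v x∈B x∈v fails = go d fails em₀
        where
        go : ∀ d → ¬ k ⊩ (x ↾ (d ℕ.+ length v)) → Dec (k ⊩ v) → ∃[ L ] x ∈ FirstFailure v L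
        go _       fails (no fails-v) = 0 , (x∈B , x∈v) , fails-v
        go zero    fails (yes dense)  = ⊥-elim (fails (subst (k ⊩_) (sym x∈v) dense))
        go (suc d) fails (yes dense)  = descend (x (length v)) refl
          where
          v′ : Bool → List Bool
          v′ b = v ∷ʳ b
          found : ∀ b → x (length v) ≡ b → ∃[ L ] x ∈ FirstFailure (v′ b) L
          found b eq = failure⇒first d (v′ b) x∈B (subst (λ b → x ∈ N (v′ b)) eq (N-∷ʳ {x} {v} x∈v))
            (subst (λ m → ¬ k ⊩ (x ↾ m))
              (sym (trans (cong (d ℕ.+_) (length-∷ʳ v b)) (ℕₚ.+-suc d (length v)))) fails)
          descend : ∀ b → x (length v) ≡ b → ∃[ L ] x ∈ FirstFailure v L
          descend true  eq = let L , x∈ = found true  eq in suc L , dense , inj₁ x∈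
          descend false eq = let L , x∈ = found false eq in suc L , dense , inj₂ x∈

    open FirstFailure

    Survivors : ℕ → List Bool → PointSet
    Survivors k t x = x ∈ B × x ∈ N t × (∀ {n} → length t ℕ.≤ n → k ⊩ (x ↾ n))

    -- Of the measure of `B` in `N t`, at least (1 - 2^-(k+1)) μ(N t), the failures take at most (1
    -- - 2^-k) μ(N t). The difference is 2^-(k+1) μ(N t).
    μ-Survivors : ∀ {k t} → suc k ⊩ t → μ[ Survivors k t ]≥ (2^- (suc k ℕ.+ length t))
    μ-Survivors {k} {t} dense μ< = dense (subst (λ q → μ[ B ∩ N t ]< q) total
      (μ<-⊆ {B ∩ N t} {Survivors k t ∪ ⋃[ L ∶ ℕ ] FirstFailure k t L} (λ {x} → split {x})
        (μ-∪-< {Survivors k t} {⋃[ L ∶ ℕ ] FirstFailure k t L} μ< (μ-⋃FirstFailure k t))))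
      where
      split : (B ∩ N t) ⊆ Survivors k t ∪ ⋃[ L ∶ ℕ ] FirstFailure k t L
      split {x} (x∈B , x∈t) = go em₀
        where
        go : Dec (∀ n → length t ℕ.≤ n → k ⊩ (x ↾ n)) → x ∈ Survivors k t ∪ ⋃[ L ∶ ℕ ] FirstFailure k t L
        go (yes dense) = inj₁ (x∈B , x∈t , λ {n} → dense n)
        go (no fails)  =
          let n , ¬dense = ¬∀⇒∃¬₀ fails
              ℓ≤n   = decidable-stable em₀ λ ℓ≰n → ¬dense λ ℓ≤n → ⊥-elim (ℓ≰n ℓ≤n)
          in inj₂ (failure⇒first k (n ℕ.∸ length t) t x∈B x∈t
               (subst (λ m → ¬ k ⊩ (x ↾ m)) (sym (ℕₚ.m∸n+n≡m ℓ≤n)) λ d → ¬dense λ _ → d))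
      total : 2^- (suc k ℕ.+ length t) + θ k t ≡ θ (suc k) t
      total = trans (cong₂ (λ p m → p + (1ℚ - 2^- k) * m) (2^-+ (suc k) (length t)) (μN-length t))
        (trans (solve 2 (λ h m → con ½ :* h :* m :+ (con 1ℚ :- h) :* m := (con 1ℚ :- con ½ :* h) :* m) refl
            (2^- k) (2^- length t))
          (cong (λ m → (1ℚ - 2^- suc k) * m) (sym (μN-length t))))

    -- Raising and lowering the density along a path

    Between : (List Bool → Set) → List Bool → List Bool → Set
    Between P s t = ∀ {v} → s ≼ v → v ≼ t → P v

    -- The survivors have positive measure, hence density close to 1 in some cylinder `N u`. A
    -- survivor in it traces a path from `t` to `u` on which density `k` never fails.
    climb : ∀ {k t} M → suc k ⊩ t → ∃[ u ] t ≼ u × suc M ⊩ u × Between (k ⊩_) t u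
    climb {k} {t} M dense = go (ℕₚ.≤-total (length t) (length u))
      where
      A = Survivors k t
      found = lebesgue {A} (suc k ℕ.+ length t) (μ-Survivors {k} {t} dense) (suc M)
      u = proj₁ found
      dense-u : μ[ A ∩ N u ]≥ θ (suc M) u
      dense-u = proj₂ found
      point : ∃[ x ] x ∈ A ∩ N u
      point = decidable-stable em₀ λ none →
        dense-u (μ∅≤0 {A ∩ N u} (λ x x∈ → none (x , x∈)) (θ-pos M u))
      x = proj₁ point
      x∈t : x ∈ N t
      x∈t = proj₁ (proj₂ (proj₁ (proj₂ point)))
      x∈u : x ∈ N u
      x∈u = proj₂ (proj₂ point)
      between : ∀ {w} → x ∈ N w → Between (k ⊩_) t w
      between x∈w {v} t≼v v≼w =
        subst (k ⊩_) (N-anti {v} v≼w x∈w) (proj₂ (proj₂ (proj₁ (proj₂ point))) (≼-length t≼v))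
      go : length t ℕ.≤ length u ⊎ length u ℕ.≤ length t →
           ∃[ u ] t ≼ u × suc M ⊩ u × Between (k ⊩_) t u
      go (inj₁ t≤u) = u , N-comparable {x} x∈t x∈u t≤u ,
        (λ μ< → dense-u (μ<-⊆ {A ∩ N u} {B ∩ N u} (λ ((y∈B , _) , y∈u) → y∈B , y∈u) μ<)) ,
        λ {v} → between x∈u {v}
      -- A `u` no longer than `t` is replaced by `t`: all survivors lie in `N t`, whose measure is
      -- at most that of `N u`.
      go (inj₂ u≤t) = t , ≼-refl ,
        (λ μ< → dense-u (μ<-weaken {A ∩ N u} (θ-≼ (suc M) {u} {t} u≤t)
          (μ<-⊆ {A ∩ N u} {B ∩ N t} (λ ((y∈B , y∈t , _) , _) → y∈B , y∈t) μ<))) ,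
        λ {v} → between x∈t {v}

    ≼-cases : ∀ {s b v} → s ≼ v → ∀ {u} → s ∷ʳ b ≼ u → v ≼ u → v ≡ s ⊎ s ∷ʳ b ≼ v
    ≼-cases {s} {b} {v} s≼v {u} sb≼u v≼u with m≤n⇒m<n∨m≡n (≼-length s≼v)
    ... | inj₁ s<v = inj₂ (N-comparable {nth u} (N-anti {s ∷ʳ b} sb≼u (nth-∈N u)) (N-anti {v} v≼u (nth-∈N u))
                       (ℕₚ.≤-trans (ℕₚ.≤-reflexive (length-∷ʳ s b)) s<v))
    ... | inj₂ s≡v = inj₁ (sym (≼-equal s≼v (ℕₚ.≤-reflexive (sym s≡v))))

    -- Follow `w` bit by bit to the first string failing `suc k`. Its predecessor still satisfies
    -- `suc k`, so by `⊩-∷ʳ` it satisfies `k` itself.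
    drop : ∀ {k} w s → suc k ⊩ s → ¬ suc k ⊩ (s ++ w) →
           ∃[ t ] s ≼ t × ¬ suc k ⊩ t × Between (k ⊩_) s t
    drop {k} []      s dense fails = ⊥-elim (fails (subst (suc k ⊩_) (sym (++-identityʳ s)) dense))
    drop {k} (b ∷ w) s dense fails = go em₀
      where
      k⊩s : k ⊩ s
      k⊩s = ⊩-anti {k} {suc k} {s} (n≤1+n k) dense
      go : Dec (suc k ⊩ s ∷ʳ b) → ∃[ t ] s ≼ t × ¬ suc k ⊩ t × Between (k ⊩_) s t
      go (no fails-sb) = s ∷ʳ b , ≼-∷ʳ b , fails-sb , between
        where
        between : Between (k ⊩_) s (s ∷ʳ b)
        between {v} s≼v v≼sb = choose (≼-cases s≼v ≼-refl v≼sb)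
          where
          choose : v ≡ s ⊎ s ∷ʳ b ≼ v → k ⊩ v
          choose (inj₁ v≡s)  = subst (k ⊩_) (sym v≡s) k⊩s
          choose (inj₂ sb≼v) = subst (k ⊩_) (≼-equal sb≼v (≼-length v≼sb)) (⊩-∷ʳ {k} {s} b dense)
      go (yes dense-sb) =
        let t , sb≼t , fails-t , between-sb = drop {k} w (s ∷ʳ b) dense-sb
              (subst (λ u → ¬ suc k ⊩ u) (sym (∷ʳ-++ s b w)) fails)
        in t , ≼-trans (≼-∷ʳ b) sb≼t , fails-t , λ {v} s≼v v≼t →
           choose sb≼t between-sb (≼-cases s≼v sb≼t v≼t) v≼t
        where
        choose : ∀ {t v} → s ∷ʳ b ≼ t → Between (k ⊩_) (s ∷ʳ b) t → v ≡ s ⊎ s ∷ʳ b ≼ v → v ≼ t → k ⊩ v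
        choose _ _       (inj₁ v≡s)  _   = subst (k ⊩_) (sym v≡s) k⊩s
        choose _ between (inj₂ sb≼v) v≼t = between sb≼v v≼t

  -- Wadge reducibility

  preimage-open : ∀ {f U} → Continuous f → IsOpen U → IsOpen (f ⊢ U)
  preimage-open continuous openU {x} fx∈U =
    let n , N⊆U = openU fx∈U ; m , N⊆ = continuous x n in m , λ y∈ → N⊆U (N⊆ y∈)

  Π⁰₃-≤W : ∀ {A B} → A ≤W B → B ∈ Π⁰₃ → A ∈ Π⁰₃
  Π⁰₃-≤W (f , continuous , to , from) (F , closed , B⊆ , ⊆B) =
    (λ n m → f ⊢ F n m) , (λ n m → preimage-open {f} continuous (closed n m)) ,
    (λ x∈A → B⊆ (to x∈A)) , (λ x∈ → from (⊆B x∈))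

  Σ⁰₃-≤W : ∀ {A B} → A ≤W B → B ∈ Σ⁰₃ → A ∈ Σ⁰₃
  Σ⁰₃-≤W (f , continuous , to , from) (G , open-G , B⊆ , ⊆B) =
    (λ n m → f ⊢ G n m) , (λ n m → preimage-open {f} continuous (open-G n m)) ,
    (λ x∈A → B⊆ (to x∈A)) , (λ x∈ → from (⊆B x∈))

  ≤W-trans : ∀ {A B C} → A ≤W B → B ≤W C → A ≤W C
  ≤W-trans (f , cf , f-to , f-from) (g , cg , g-to , g-from) =
    g ∘ f
    , (λ x n → let m , N⊆ = cg (f x) n ; k , N⊆′ = cf x m in k , λ y∈ → N⊆ (N⊆′ y∈))
    , (λ x∈ → g-to (f-to x∈)) , (λ x∈ → f-from (g-from x∈))

  ≡W-trans : ∀ {A B C} → A ≡W B → B ≡W C → A ≡W C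
  ≡W-trans {A} {B} {C} (A≤B , B≤A) (B≤C , C≤B) = ≤W-trans {A} {B} {C} A≤B B≤C , ≤W-trans {C} {B} {A} C≤B B≤A

  ≡W-sym : ∀ {A B} → A ≡W B → B ≡W A
  ≡W-sym (A≤B , B≤A) = B≤A , A≤B

  𝐝⇒≡W𝐗 : ∀ {Y} → Y ∈ 𝐝 → Y ≡W 𝐗
  𝐝⇒≡W𝐗 (Y∈Π⁰₃@(F , closed , Y⊆ , ⊆Y) , Y∉Δ⁰₃) =
    Π⁰₃⇒≤W𝐗 Y∈Π⁰₃ , Hardness.¬Σ⁰₃⇒𝐗≤W F closed Y⊆ ⊆Y λ Y∈Σ⁰₃ → Y∉Δ⁰₃ (Y∈Π⁰₃ , Y∈Σ⁰₃)

  hard-Π⁰₃⇒𝐝 : ∀ {Y} → Y ∈ Π⁰₃ → 𝐗 ≤W Y → Y ∈ 𝐝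
  hard-Π⁰₃⇒𝐝 Y∈Π⁰₃ 𝐗≤Y = Y∈Π⁰₃ , λ (_ , Y∈Σ⁰₃) → 𝐗∉Σ⁰₃ (Σ⁰₃-≤W 𝐗≤Y Y∈Σ⁰₃)

  𝐝-isWadgeDegree : IsWadgeDegree 𝐝
  𝐝-isWadgeDegree = 𝐗 , λ Y → mk⇔ 𝐝⇒≡W𝐗
    λ (Y≤𝐗 , 𝐗≤Y) → hard-Π⁰₃⇒𝐝 (Π⁰₃-≤W Y≤𝐗 𝐗∈Π⁰₃) 𝐗≤Y

  -- Sets of density points

  module _ (B : PointSet) where

    open Density B

    Φ-intro : ∀ {x} → (∀ k → Eventually λ n → k ⊩ (x ↾ n)) → x ∈ Φ B
    Φ-intro {x} dense {ε} 0<ε =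
      let k , 2^-k<ε = archimedean 0<ε
          T , dense-k = dense k
      in T , λ {n} T≤n →
        (λ μ< → dense-k T≤n (μ<-weaken {B ∩ N (x ↾ n)}
          (*-monoʳ (<⇒≤ (μN-pos (x ↾ n))) (1-anti (<⇒≤ 2^-k<ε))) μ<)) ,
        -- The upper density bound is automatic, as the relative measure never exceeds 1.
        μ≤-⊆ {B ∩ N (x ↾ n)} {N (x ↾ n)} proj₂ (μ≤-weaken {N (x ↾ n)} (1+ε (x ↾ n)) (μN≤ (x ↾ n)))
      where
      1+ε : ∀ s → μN s ≤ (1ℚ + ε) * μN s
      1+ε s = subst (_≤ (1ℚ + ε) * μN s) (*-identityˡ (μN s))
                (*-monoʳ {1ℚ} {1ℚ + ε} (<⇒≤ (μN-pos s)) (p≤p+q (<⇒≤ 0<ε)))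

    Φ-elim : ∀ {x} → x ∈ Φ B → ∀ k → Eventually λ n → k ⊩ (x ↾ n)
    Φ-elim x∈Φ k = let T , bounds = x∈Φ (2^-pos k) in T , λ T≤n → proj₁ (bounds T≤n)

    Φ∈Π⁰₃ : Φ B ∈ Π⁰₃
    Φ∈Π⁰₃ = F , closed , (λ x∈Φ → Φ-elim x∈Φ) , (λ dense → Φ-intro dense)
      where
      F : ℕ → ℕ → PointSet
      F k T x = ∀ {n} → T ℕ.≤ n → k ⊩ (x ↾ n)
      closed : ∀ k T → IsClosed (F k T)
      closed k T {x} x∉ =
        let n , fails = ¬∀⇒∃¬₀ {P = λ n → T ℕ.≤ n → k ⊩ (x ↾ n)} (λ dense → x∉ λ {n} → dense n)
        in n , λ {y} y∈ dense → fails λ T≤n → subst (k ⊩_) (∈N⇒≡-↾ {x} {y} {n} y∈) (dense T≤n)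

    -- Below a string where B is dense the density can be made to dip to any
    -- prescribed level, up to a factor, because it must vanish somewhere; the
    -- survivors of climb bring it back up.
    module Dips (null-below : ∀ s → ∃[ t ] s ≼ t × Null (B ∩ N t)) where

      -- The surplus 2 in `dense` pays for an event: at level `n` one unit is lost in `drop` and one
      -- more in `climb`.
      record State : Set where
        field
          depth : ℕ
          str   : List Bool
          dense : 2 ℕ.+ depth ⊩ str

      open State

      record Next (σ : State) (n : ℕ) : Set where
        field
          state   : State
          deeper  : depth state ≡ suc n
          dip     : List Bool
          before  : str σ ≼ dip
          after   : dip ≼ str state
          fails   : ¬ 2 ℕ.+ n ⊩ dip
          between : Between (n ⊩_) (str σ) (str state)
          strict  : length (str σ) ℕ.< length (str state)

      open Next

      abstract
        next : ∀ σ n → n ℕ.≤ depth σ → Next σ n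
        next σ n n≤d =
          let t₀ , (w , s++w≡t₀) , null = null-below (str σ)
              t , s≼t , fails-t , between-st = drop {suc n} w (str σ) dense-s
                (subst (λ t → ¬ 2 ℕ.+ n ⊩ t) (sym s++w≡t₀) λ d → d (null (θ-pos (suc n) t₀)))
              -- The dip still satisfies `suc n`, which lets `climb` stay at `n` or better; the
              -- density `3 + n` reached is the invariant for the new depth `suc n`.
              u , t≼u , dense-u , between-tu = climb {n} {t} (2 ℕ.+ n) (between-st s≼t ≼-refl)
          in assemble s≼t fails-t between-st t≼u dense-u between-tu
          where
          s : List Bool
          s = str σ
          dense-s : 2 ℕ.+ n ⊩ s
          dense-s = ⊩-anti {2 ℕ.+ n} {2 ℕ.+ depth σ} {s} (s≤s (s≤s n≤d)) (dense σ)
          assemble : ∀ {t u} → s ≼ t → ¬ 2 ℕ.+ n ⊩ t → Between (suc n ⊩_) s t →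
                     t ≼ u → 3 ℕ.+ n ⊩ u → Between (n ⊩_) t u → Next σ n
          assemble {t} {u} s≼t fails-t between-st t≼u dense-u between-tu = record
            { state   = record { depth = suc n ; str = u ; dense = dense-u }
            ; deeper  = refl
            ; dip     = t
            ; before  = s≼t
            ; after   = t≼u
            ; fails   = fails-t
            ; between = λ {v} s≼v v≼u → path s≼v v≼u (ℕₚ.≤-total (length v) (length t))
            ; strict  = ℕₚ.<-≤-trans
                (ℕₚ.≰⇒> λ t≤s → fails-t (subst (2 ℕ.+ n ⊩_) (≼-equal s≼t t≤s) dense-s))
                (≼-length t≼u)
            }
            where
            path : ∀ {v} → s ≼ v → v ≼ u → length v ℕ.≤ length t ⊎ length t ℕ.≤ length v → n ⊩ v
            path {v} s≼v v≼u (inj₁ v≤t) = ⊩-anti {n} {suc n} {v} (n≤1+n n) (between-st s≼v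
              (N-comparable {nth u} (N-anti {v} v≼u (nth-∈N u)) (N-anti {t} t≼u (nth-∈N u)) v≤t))
            path {v} s≼v v≼u (inj₂ t≤v) = between-tu
              (N-comparable {nth u} (N-anti {t} t≼u (nth-∈N u)) (N-anti {v} v≼u (nth-∈N u)) t≤v) v≼u

      nextOf : ∀ σ e → Next σ (e ⊓ depth σ)
      nextOf σ e = next σ (e ⊓ depth σ) (m⊓n≤n e (depth σ))

      module Reduction (init : State) where

        open Process State init depth str (λ σ e → state (nextOf σ e))
          (λ σ e → deeper (nextOf σ e)) (λ σ e → ≼-trans (before (nextOf σ e)) (after (nextOf σ e)))
          (λ σ e → strict (nextOf σ e))

        dense-between : ∀ {x k T} → (∀ {t} → T ℕ.≤ t → k ℕ.≤ level x t) →
                        ∀ d → Between (k ⊩_) (str (run x T)) (str (run x (suc d ℕ.+ T)))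
        dense-between {x} {k} {T} above d {v} T≼v v≼ = go d v≼
          where
          lim∈v : ∀ d → v ≼ str (run x (d ℕ.+ T)) → limit x ∈ N v
          lim∈v d v≼ = N-anti {v} v≼ (limit∈N x (d ℕ.+ T))
          last : ∀ d → str (run x (d ℕ.+ T)) ≼ v → v ≼ str (run x (suc d ℕ.+ T)) → k ⊩ v
          last d s≼v v≼ = ⊩-anti {k} {level x (d ℕ.+ T)} {v} (above (m≤n+m T d))
            (between (nextOf (run x (d ℕ.+ T)) (event x (d ℕ.+ T))) s≼v v≼)
          go : ∀ d → v ≼ str (run x (suc d ℕ.+ T)) → k ⊩ v
          go zero    v≼ = last zero T≼v v≼
          go (suc d) v≼ = choose (ℕₚ.≤-total (length v) (length s))
            where
            s = str (run x (suc d ℕ.+ T))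
            choose : length v ℕ.≤ length s ⊎ length s ℕ.≤ length v → k ⊩ v
            choose (inj₁ v≤s) = go d
              (N-comparable {limit x} (lim∈v (2 ℕ.+ d) v≼) (limit∈N x (suc d ℕ.+ T)) v≤s)
            choose (inj₂ s≤v) = last (suc d)
              (N-comparable {limit x} (limit∈N x (suc d ℕ.+ T)) (lim∈v (2 ℕ.+ d) v≼) s≤v) v≼

        ∈𝐗⇒limit∈Φ : ∀ {x} → x ∈ 𝐗 → limit x ∈ Φ B
        ∈𝐗⇒limit∈Φ {x} x∈𝐗 = Φ-intro λ k →
          let T , above = level→∞ x∈𝐗 k in
          length (str (run x T)) , λ {n} ℓ≤n → dense-between {x} {k} {T} above n
            (≼-↾ (limit∈N x T) ℓ≤n)
            (↾-≼ {limit x} (limit∈N x (suc n ℕ.+ T))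
              (ℕₚ.≤-trans (ℕₚ.≤-trans (n≤1+n n) (m≤m+n (suc n) T)) (str-length x (suc n ℕ.+ T))))

        -- If levels below a fixed `n` recur, each leaves a dip along the limit that fails density
        -- `2 + n`, at a length no smaller than the time.
        limit∈Φ⇒∈𝐗 : ∀ {x} → limit x ∈ Φ B → x ∈ 𝐗
        limit∈Φ⇒∈𝐗 {x} lim∈Φ = decidable-stable em₀ λ x∉𝐗 →
          let n , freq        = level-frequently x∉𝐗
              T , dense-n     = Φ-elim lim∈Φ (2 ℕ.+ n)
              t , T≤t , level<n = freq T
          in dips t level<n (λ {m} → dense-n {m}) T≤t
          where
          dips : ∀ t {n T} → level x t ℕ.< n → (∀ {m} → T ℕ.≤ m → 2 ℕ.+ n ⊩ (limit x ↾ m)) → T ℕ.≤ t → ⊥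
          dips t {n} {T} level<n dense-n T≤t = fails nxt
            (⊩-anti {2 ℕ.+ level x t} {2 ℕ.+ n} {dip nxt} (s≤s (s≤s (ℕₚ.<⇒≤ level<n)))
              (subst (2 ℕ.+ n ⊩_) (N-anti {dip nxt} (after nxt) (limit∈N x (suc t)))
                (dense-n (ℕₚ.≤-trans T≤t (ℕₚ.≤-trans (str-length x t) (≼-length (before nxt)))))))
            where
            nxt : Next (run x t) (level x t)
            nxt = nextOf (run x t) (event x t)

        reduction : 𝐗 ≤W Φ B
        reduction = limit , limit-continuous , ∈𝐗⇒limit∈Φ , limit∈Φ⇒∈𝐗

      Φ∈𝐝 : Positive B → Φ B ∈ 𝐝
      Φ∈𝐝 (q , 0<q , large) =
        let j , 2^-j<q = archimedean 0<q
            -- The precision 2 is the invariant of `State` at depth 0.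
            u , dense  = lebesgue {B} j (λ μ< → large (μ<-weaken {B} (<⇒≤ 2^-j<q) μ<)) 2
        in hard-Π⁰₃⇒𝐝 Φ∈Π⁰₃ (Reduction.reduction record { depth = 0 ; str = u ; dense = dense })

  -- The coin-tossing measure of the Cantor space

  -- The measure of N s ∩ N w.
  μ∩ : List Bool → List Bool → ℚ
  μ∩ []          w           = μN w
  μ∩ (a ∷ s)     []          = μN (a ∷ s)
  μ∩ (true ∷ s)  (true ∷ w)  = ½ * μ∩ s w
  μ∩ (false ∷ s) (false ∷ w) = ½ * μ∩ s w
  μ∩ (true ∷ s)  (false ∷ w) = 0ℚ
  μ∩ (false ∷ s) (true ∷ w)  = 0ℚ

  μ∩-self : ∀ s → μ∩ s s ≡ μN s
  μ∩-self []          = refl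
  μ∩-self (true ∷ s)  = cong (½ *_) (μ∩-self s)
  μ∩-self (false ∷ s) = cong (½ *_) (μ∩-self s)

  μ∩-[] : ∀ s → μ∩ s [] ≡ μN s
  μ∩-[] []      = refl
  μ∩-[] (_ ∷ s) = refl

  ½*-nonneg : ∀ {p} → 0ℚ ≤ p → 0ℚ ≤ ½ * p
  ½*-nonneg {p} 0≤p = subst (_≤ ½ * p) (*-zeroʳ ½) (*-monoˡ (nonNegative⁻¹ ½) 0≤p)

  μ∩-nonneg : ∀ s w → 0ℚ ≤ μ∩ s w
  μ∩-nonneg []          w           = <⇒≤ (μN-pos w)
  μ∩-nonneg (a ∷ s)     []          = <⇒≤ (μN-pos (a ∷ s))
  μ∩-nonneg (true ∷ s)  (true ∷ w)  = ½*-nonneg (μ∩-nonneg s w)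
  μ∩-nonneg (false ∷ s) (false ∷ w) = ½*-nonneg (μ∩-nonneg s w)
  μ∩-nonneg (true ∷ s)  (false ∷ w) = ℚₚ.≤-refl
  μ∩-nonneg (false ∷ s) (true ∷ w)  = ℚₚ.≤-refl

  μ∩-split : ∀ s w → μ∩ s (w ∷ʳ true) + μ∩ s (w ∷ʳ false) ≡ μ∩ s w
  μ∩-split []          w           = μN-split w
  μ∩-split (true ∷ s)  []          = trans (+-identityʳ (½ * μ∩ s [])) (cong (½ *_) (μ∩-[] s))
  μ∩-split (false ∷ s) []          = trans (+-identityˡ (½ * μ∩ s [])) (cong (½ *_) (μ∩-[] s))
  μ∩-split (true ∷ s)  (true ∷ w)  =
    trans (sym (*-distribˡ-+ ½ (μ∩ s (w ∷ʳ true)) (μ∩ s (w ∷ʳ false)))) (cong (½ *_) (μ∩-split s w))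
  μ∩-split (false ∷ s) (false ∷ w) =
    trans (sym (*-distribˡ-+ ½ (μ∩ s (w ∷ʳ true)) (μ∩ s (w ∷ʳ false)))) (cong (½ *_) (μ∩-split s w))
  μ∩-split (true ∷ s)  (false ∷ w) = refl
  μ∩-split (false ∷ s) (true ∷ w)  = refl

  -- A cylinder in which the cover has relative total weight at most r < 1 has a
  -- half with the same property; the resulting branch avoids the cover.
  μ-whole : μ[ (λ _ → ⊤) ]≥ 1ℚ
  μ-whole (s , cover , r , r<1 , bound) =
    -- At a string of the cover lying on the branch, that string alone contributes relative weight
    -- 1, which exceeds `r`.
    let i , x∈si = cover {x} tt in <-irrefl refl (begin-strict
      r * μN (s i)                         <⟨ *-monoˡ-<-pos (μN (s i)) {{ℚ.positive (μN-pos (s i))}} r<1 ⟩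
      1ℚ * μN (s i)                        ≡⟨ *-identityˡ (μN (s i)) ⟩
      μN (s i)                             ≡⟨ μ∩-self (s i) ⟨
      term (s i) i                         ≤⟨ last≤∑ (s i) i ⟩
      ∑ (term (s i)) (suc i)               ≤⟨ subst Light x∈si (light (length (s i))) (suc i) ⟩
      r * μN (s i)                         ∎)
    where
    open ℚₚ.≤-Reasoning
    term : List Bool → ℕ → ℚ
    term w i = μ∩ (s i) w
    term-nonneg : ∀ w i → 0ℚ ≤ term w i
    term-nonneg w i = μ∩-nonneg (s i) w
    last≤∑ : ∀ w i → term w i ≤ ∑ (term w) (suc i)
    last≤∑ w i = subst₂ _≤_ (+-identityˡ (term w i)) (sym (∑-suc (term w) i))
      (+-monoˡ-≤ (term w i) (∑-nonneg (term-nonneg w) i))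
    Light : List Bool → Set
    Light w = ∀ n → ∑ (term w) n ≤ r * μN w
    light-[] : Light []
    light-[] n = subst₂ _≤_ (∑-cong n λ {i} _ → sym (μ∩-[] (s i))) (sym (*-identityʳ r)) (bound n)
    one-half : ∀ {w} → Light w → ¬ Light (w ∷ʳ true) → Light (w ∷ʳ false)
    one-half {w} light-w ¬light n₂ = ≮⇒≥ λ heavy₂ →
      let n₁ , ¬≤ = ¬∀⇒∃¬₀ ¬light
          n = n₁ ⊔ n₂
      in <-irrefl refl (begin-strict
        r * μN w                                          ≡⟨ cong (r *_) (μN-split w) ⟨
        r * (μN (w ∷ʳ true) + μN (w ∷ʳ false))            ≡⟨ *-distribˡ-+ r (μN (w ∷ʳ true)) (μN (w ∷ʳ false)) ⟩
        r * μN (w ∷ʳ true) + r * μN (w ∷ʳ false)          <⟨ +-mono-< (≰⇒> ¬≤) heavy₂ ⟩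
        ∑ (term (w ∷ʳ true)) n₁ + ∑ (term (w ∷ʳ false)) n₂
          ≤⟨ +-mono-≤ (∑-mono-index (term-nonneg (w ∷ʳ true)) (m≤m⊔n n₁ n₂))
                      (∑-mono-index (term-nonneg (w ∷ʳ false)) (m≤n⊔m n₁ n₂)) ⟩
        ∑ (term (w ∷ʳ true)) n + ∑ (term (w ∷ʳ false)) n  ≡⟨ ∑-+ (term (w ∷ʳ true)) (term (w ∷ʳ false)) n ⟨
        ∑ (λ i → term (w ∷ʳ true) i + term (w ∷ʳ false) i) n
          ≡⟨ ∑-cong n (λ {i} _ → μ∩-split (s i) w) ⟩
        ∑ (term w) n                                      ≤⟨ light-w n ⟩
        r * μN w                                          ∎)
    choice : List Bool → Bool
    choice w = isYes (em₀ {Light (w ∷ʳ true)})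
    light-choice : ∀ {w} → Light w → Light (w ∷ʳ choice w)
    light-choice {w} light-w = go em₀
      where
      go : (d : Dec (Light (w ∷ʳ true))) → Light (w ∷ʳ isYes d)
      go (yes light)  = light
      go (no ¬light) = one-half light-w ¬light
    x : Cantor
    x = proj₁ (fixed-point choice)
    light : ∀ n → Light (x ↾ n)
    light zero    = light-[]
    light (suc n) = subst Light
      (trans (cong ((x ↾ n) ∷ʳ_) (sym (proj₂ (fixed-point choice) n))) (applyUpTo-∷ʳ x n))
      (light-choice (light n))

  -- Large sets with a dense open complement

  -- Every string is some `string i`, so the holes form a dense open set; the appended falses keep
  -- its total measure at most `2^- k`.
  hole : ℕ → ℕ → List Bool
  hole k i = string i ++ replicate (suc (k ℕ.+ i)) false

  μN-hole : ∀ k i → μN (hole k i) ≤ 2^- suc (k ℕ.+ i)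
  μN-hole k i = subst (_≤ 2^- suc (k ℕ.+ i)) (sym (μN-length (hole k i)))
    (2^-anti (ℕₚ.≤-trans (m≤n+m (suc (k ℕ.+ i)) (length (string i)))
      (ℕₚ.≤-reflexive (sym (trans (length-++ (string i))
        (cong (length (string i) ℕ.+_) (length-replicate (suc (k ℕ.+ i)))))))))

  holesFrom : ℕ → ℕ → PointSet
  holesFrom k n = ⋃[ i ∶ ℕ ] N (hole k (n ℕ.+ i))

  μ-holesFrom : ∀ k n → μ[ holesFrom k n ]≤ (2^- (k ℕ.+ n))
  μ-holesFrom k n = μ-⋃ (λ i → N (hole k (n ℕ.+ i))) (λ i → 2^- suc ((k ℕ.+ n) ℕ.+ i))
    (λ i {q} → μ≤-weaken {N (hole k (n ℕ.+ i))}
      (subst (λ m → μN (hole k (n ℕ.+ i)) ≤ 2^- suc m) (sym (ℕₚ.+-assoc k n i)) (μN-hole k (n ℕ.+ i)))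
      (μN≤ (hole k (n ℕ.+ i))) {q})
    (∑-2^-≤ (k ℕ.+ n))

  porous : ℕ → PointSet
  porous k = ∁ (holesFrom k 0)

  before-holes : ℕ → ℕ → PointSet
  before-holes k n x = ∀ {i} → i ℕ.< n → x ∉ N (hole k i)

  before-holes-open : ∀ k n → IsOpen (before-holes k n)
  before-holes-open k zero    _  = 0 , λ _ ()
  before-holes-open k (suc n) {x} x∈ =
    let m , ⊆both = ∩-open {before-holes k n} {∁ (N (hole k n))} (before-holes-open k n) (∉N-open (hole k n)) {x}
                      ((λ {i} i<n → x∈ {i} (ℕₚ.m<n⇒m<1+n i<n)) , x∈ (ℕₚ.n<1+n n))
    in m , λ {y} y∈ → extend y (⊆both {y} y∈)
    where
    extend : ∀ y → y ∈ before-holes k n ∩ ∁ (N (hole k n)) → y ∈ before-holes k (suc n)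
    extend y (old , new) {i} i<1+n with ℕₚ.m≤n⇒m<n∨m≡n (ℕₚ.≤-pred i<1+n)
    ... | inj₁ i<n  = old i<n
    ... | inj₂ refl = new

  porous⊆before-holes : ∀ k n → porous k ⊆ before-holes k n
  porous⊆before-holes k n x∈ {i} _ x∈i = x∈ (i , x∈i)

  -- Avoiding the first `suc j` holes is an open condition, and the excess lies in the remaining
  -- holes. Half of `2^- j` is spent on approximating `A` and half on these holes.
  ∩-porous-measurable : ∀ {A} k → Measurable A → Measurable (A ∩ porous k)
  ∩-porous-measurable {A} k measurable {ε} 0<ε =
    let j , 2^-j<ε = archimedean 0<ε
        U , openU , A⊆U , small = measurable (2^-pos (suc j))
    in approximate j 2^-j<ε U openU A⊆U small
    where
    approximate : ∀ j → 2^- j < ε → ∀ U → IsOpen U → A ⊆ U → μ[ U ∖ A ]< (2^- suc j) →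
                  Σ[ V ∈ PointSet ] IsOpen V × (A ∩ porous k) ⊆ V × μ[ V ∖ (A ∩ porous k) ]< ε
    approximate j 2^-j<ε U openU A⊆U small =
        U ∩ V , ∩-open openU (before-holes-open k (suc j))
      , (λ (x∈A , x∈P) → A⊆U x∈A , porous⊆before-holes k (suc j) x∈P)
      , μ<-⊆ {(U ∩ V) ∖ (A ∩ porous k)} {(U ∖ A) ∪ holesFrom k (suc j)} (λ {x} → split {x})
          (μ<-weaken {(U ∖ A) ∪ holesFrom k (suc j)} total
            (μ-∪-< {U ∖ A} {holesFrom k (suc j)} small (μ-holesFrom k (suc j))))
      where
      V = before-holes k (suc j)
      total : 2^- suc j + 2^- (k ℕ.+ suc j) ≤ ε
      total = ℚₚ.≤-trans (+-monoʳ-≤ (2^- suc j) (2^-anti (m≤n+m (suc j) k)))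
        (ℚₚ.≤-trans (ℚₚ.≤-reflexive (2^-double j)) (<⇒≤ 2^-j<ε))
      split : ((U ∩ V) ∖ (A ∩ porous k)) ⊆ (U ∖ A) ∪ holesFrom k (suc j)
      split {x} ((x∈U , x∈V) , x∉) = go em₀
        where
        go : Dec (x ∈ A) → x ∈ (U ∖ A) ∪ holesFrom k (suc j)
        go (no x∉A)  = inj₁ (x∈U , x∉A)
        go (yes x∈A) =
          let i , x∈i = decidable-stable em₀ (λ x∈P → x∉ (x∈A , x∈P))
              j<i = ℕₚ.≮⇒≥ λ i<1+j → x∈V i<1+j x∈i
          in inj₂ (i ℕ.∸ suc j , subst (λ i → x ∈ N (hole k i)) (sym (ℕₚ.m+[n∸m]≡n j<i)) x∈i)

  -- The parameter `suc j` makes the holes weigh at most half of `2^- j`, so at least the other half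
  -- of it is left of `A`.
  ∩-porous-positive : ∀ {A} → Positive A → ∃[ k ] Positive (A ∩ porous k)
  ∩-porous-positive {A} (q , 0<q , large) =
    let j , 2^-j<q = archimedean 0<q in suc j , 2^- suc j , 2^-pos (suc j) , λ μ< → large
      (μ<-⊆ {A} {(A ∩ porous (suc j)) ∪ holesFrom (suc j) 0} (λ {x} → split j {x})
        (μ<-weaken {(A ∩ porous (suc j)) ∪ holesFrom (suc j) 0}
          (ℚₚ.≤-trans (ℚₚ.≤-reflexive (total j)) (<⇒≤ 2^-j<q))
          (μ-∪-< {A ∩ porous (suc j)} {holesFrom (suc j) 0} μ< (μ-holesFrom (suc j) 0))))
    where
    total : ∀ j → 2^- suc j + 2^- (suc j ℕ.+ 0) ≡ 2^- j
    total j = trans (cong (λ m → 2^- suc j + 2^- m) (ℕₚ.+-identityʳ (suc j))) (2^-double j)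
    split : ∀ j → A ⊆ (A ∩ porous (suc j)) ∪ holesFrom (suc j) 0
    split j {x} x∈A = go em₀
      where
      go : Dec (x ∈ holesFrom (suc j) 0) → x ∈ (A ∩ porous (suc j)) ∪ holesFrom (suc j) 0
      go (yes x∈holes) = inj₂ x∈holes
      go (no x∉holes)  = inj₁ (x∈A , x∉holes)

  -- The hole made for `s` is a cylinder below `s` in which `B` is null, as `Dips` requires.
  almost-porous⇒Φ∈𝐝 : ∀ {B} k → Null (B ∖ porous k) → Positive B → Φ B ∈ 𝐝
  almost-porous⇒Φ∈𝐝 {B} k null = Dips.Φ∈𝐝 B λ s →
    let zeros = replicate (suc (k ℕ.+ index s)) false in
    hole k (index s) , (zeros , cong (_++ zeros) (sym (string-index s))) ,
    λ {q} → μ≤-⊆ {B ∩ N (hole k (index s))} {B ∖ porous k}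
      (λ (x∈B , x∈hole) → x∈B , λ x∈P → x∈P (index s , x∈hole)) null {q}

  -- Density in the measure algebra and uniqueness of the degree

  porous-part : (A : MALG) → Positive (set A) →
    Σ[ k ∈ ℕ ] Σ[ B ∈ MALG ] set B ⊆ set A ∩ porous k × Positive (set B)
  porous-part A positive = let k , positive′ = ∩-porous-positive positive in
    k , record { set = set A ∩ porous k ; measurable = ∩-porous-measurable k (measurable A) } , id , positive′

  null-∖ : ∀ {A B} → A ⊆ B → Null (A ∖ B)
  null-∖ {A} {B} A⊆B = μ∅≤0 {A ∖ B} λ x (x∈A , x∉B) → x∉B (A⊆B x∈A)

  𝒲𝐝-dense : Dense (𝒲 𝐝)
  𝒲𝐝-dense A positive =
    let k , B , B⊆ , positive′ = porous-part A positive in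
    B , almost-porous⇒Φ∈𝐝 k (null-∖ {set B} {porous k} (λ x∈B → proj₂ (B⊆ x∈B))) positive′ ,
    positive′ , null-∖ {set B} {set A} (λ x∈B → proj₁ (B⊆ x∈B))

  whole : MALG
  whole = record
    { set        = λ _ → ⊤
    ; measurable = λ {ε} 0<ε → (λ _ → ⊤) , (λ _ → 0 , λ _ → tt) , (λ _ → tt) ,
                     null-∖ {λ _ → ⊤} {λ _ → ⊤} id 0<ε
    }

  whole-positive : Positive (set whole)
  whole-positive = 1ℚ , positive⁻¹ 1ℚ , μ-whole

  -- Below a porous element of MALG every Φ(B) is in 𝐝, so the two degrees meet.
  𝐝-unique : ∀ 𝐞 → IsWadgeDegree 𝐞 → Dense (𝒲 𝐞) → 𝐞 ≐ 𝐝
  𝐝-unique 𝐞 (X , 𝐞⇔) dense =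
    let k , A , A⊆ , positive = porous-part whole whole-positive
        B , ΦB∈𝐞 , positive-B , B⊑A = dense A positive
        ΦB∈𝐝 = almost-porous⇒Φ∈𝐝 k
          (λ {q} → μ≤-⊆ {set B ∖ porous k} {set B ∖ set A}
            (λ (x∈B , x∉P) → x∈B , λ x∈A → x∉P (proj₂ (A⊆ x∈A))) B⊑A {q})
          positive-B
    -- `Φ (set B)` lies in both degrees, so their representatives `X` and `𝐗` are equivalent.
    in same-degree (≡W-trans (≡W-sym (to (𝐞⇔ (Φ (set B))) ΦB∈𝐞)) (𝐝⇒≡W𝐗 ΦB∈𝐝))
    where
    open Equivalence
    same-degree : X ≡W 𝐗 → 𝐞 ≐ 𝐝
    same-degree X≡𝐗 =
        (λ {Y} Y∈𝐞 → from (proj₂ 𝐝-isWadgeDegree Y) (≡W-trans (to (𝐞⇔ Y) Y∈𝐞) X≡𝐗))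
      , (λ {Y} Y∈𝐝 → from (𝐞⇔ Y) (≡W-trans (𝐝⇒≡W𝐗 Y∈𝐝) (≡W-sym X≡𝐗)))

-- Excluded middle is taken at `Set₁` because separation and thinness quantify over families of
-- point sets.
theorem1p9 : ExcludedMiddle (lsuc 0ℓ) →
    Dense (𝒲 𝐝) ×
    IsWadgeDegree 𝐝 ×
    (∀ (𝐞 : Pred PointSet (lsuc 0ℓ)) → IsWadgeDegree 𝐞 → Dense (𝒲 𝐞) → 𝐞 ≐ 𝐝)
theorem1p9 em = 𝒲𝐝-dense , 𝐝-isWadgeDegree , 𝐝-unique
  where open DensityPoints em
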